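{- Let $\mathcal{G}$ be a graph class that has either bounded treewidth, bounded independence number, bounded intersection treewidth, or bounded maximum minimal separator size. Then $\mathcal{G}$ has bounded tree-independence number.
   Context: All graphs are finite, simple, and undirected. For a graph invariant $\rho$, a graph class $\mathcal{G}$ has bounded $\rho$ if there is an integer $k$ such that $\rho(G)\le k$ for every $G\in\mathcal{G}$. A tree decomposition of a graph $G$ is a pair $\mathcal{T}=(T,\{X_t\}_{t\in V(T)})$ where $T$ is a tree and each node $t$ is assigned a bag $X_t\subseteq V(G)$ such that every vertex of $G$ is in at least one bag, every edge of $G$ has both endpoints in some common bag, and for every $u\in V(G)$ the subgraph of $T$ induced by $\{t: u\in X_t\}$ is connected. Its width is $\max_t|X_t|-1$, and the treewidth of $G$ is the minimum width of a tree decomposition of $G$. The independence number of $\mathcal{T}$ is $\alpha(\mathcal{T})=\max_{t\in V(T)}\alpha(G[X_t])$, where the independence number $\alpha(H)$ of a graph $H$ is the maximum size of an independent set in $H$. The tree-independence number of $G$ is the minimum of $\alpha(\mathcal{T})$ over all tree decompositions $\mathcal{T}$ of $G$. Given a graph $H$ and connected subgraphs $H_1,\ldots,H_p$ of $H$, their intersection graph has vertex set $\{1,\ldots,p\}$, with distinct $i,j$ adjacent if and only if $H_i$ and $H_j$ have a vertex in common. A graph $G$ is representable in $H$ if $G$ is isomorphic to the intersection graph of some connected subgraphs of $H$. The intersection treewidth of $G$ is the smallest nonnegative integer $k$ such that $G$ is representable in some graph $H$ of treewidth at most $k$. For non-adjacent distinct vertices $u,v$ of $G$, a $u,v$-separator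 is a set $S\subseteq V(G)\setminus\{u,v\}$ such that $u$ and $v$ belong to different components of $G-S$; it is a minimal $u,v$-separator if no proper subset of $S$ is a $u,v$-separator. A minimal separator of $G$ is a set that is a minimal $u,v$-separator for some non-adjacent pair $u,v$. The maximum minimal separator size of $G$ is the smallest nonnegative integer $k$ such that every minimal separator of $G$ has cardinality at most $k$ (it is $0$ if $G$ is complete). -}

module Defs where

open import Data.Empty renaming (⊥ to False) using ()
open import Data.Fin.Base using (Fin; zero; suc; inject₁; fromℕ; combine; remQuot)
open import Data.Fin.Properties using (any?; remQuot-combine) renaming (_≟_ to _≟ᶠ_)
open import Data.Fin.Subset using (Subset; Side; inside; outside; _∈_; _∉_; _⊆_; _⊂_; _∩_; ∁; ⊤; ∣_∣; Nonempty) renaming (⊥ to ∅)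
open import Data.Fin.Subset.Properties using (_∈?_; ∈⊤; ∉⊥; ∣p∣≤n; x∈p∩q⁺; x∈p∩q⁻)
open import Data.Integer.Base using (ℤ; +_; -_; _-_; _≤_; 0ℤ; 1ℤ; -1ℤ; +≤+)
import Data.Integer.Base as ℤ
import Data.Integer.Properties as ℤ
open import Data.Nat.Base using (ℕ; zero; suc; z≤n)
import Data.Nat.Base as ℕ
open import Data.Product using (Σ; ∃; ∃-syntax; _×_; _,_; proj₁; proj₂)
open import Data.Sum.Base using (_⊎_; inj₁; inj₂)
open import Data.Vec.Base using ([]; _∷_; lookup; tabulate; here; there)
open import Data.Vec.Properties using ([]=⇒lookup; lookup⇒[]=; lookup∘tabulate)
open import Data.Vec.Properties.WithK using ([]=-irrelevant)
open import Function.Base using (_∘_)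
open import Function.Bundles using (_↔_; _⇔_; mk↔ₛ′; mk⇔; module Inverse)
open import Function.Definitions using (Injective)
open import Level using (Level; 0ℓ) renaming (suc to lsuc; _⊔_ to _⊔ˡ_)
open import Relation.Binary.Construct.Closure.ReflexiveTransitive using (Star; ε; _◅_)
open import Relation.Binary.Definitions using (Decidable)
open import Relation.Binary.PropositionalEquality using (_≡_; _≢_; refl; sym; trans; cong; subst)
open import Relation.Nullary using (¬_; Dec; yes; no)
open import Relation.Nullary.Decidable using (_×-dec_; _⊎-dec_; ¬?; ⌊_⌋)
open import Relation.Nullary.Negation using (contradiction)
import Relation.Unary as U

private variable
  a ℓ : Level
  n m : ℕ

-- The vertices are a subset of the ambient set Fin n rather than all of
-- it, so that every subgraph of a graph is again a Graph over the same
-- ambient set.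
record Graph (n : ℕ) : Set₁ where
  field
    V       : Subset n
    _~_     : Fin n → Fin n → Set
    _~?_    : Decidable _~_
    ~-sym   : ∀ {u v} → u ~ v → v ~ u
    ~-irrefl : ∀ {u} → ¬ u ~ u
    ~⇒∈V    : ∀ {u v} → u ~ v → u ∈ V

open Graph public using (V)

_⊢_~_ : (G : Graph n) → Fin n → Fin n → Set
G ⊢ u ~ v = Graph._~_ G u v

_⊆ᴳ_ : Graph n → Graph n → Set
H ⊆ᴳ G = V H ⊆ V G × (∀ {u v} → H ⊢ u ~ v → G ⊢ u ~ v)

_[_] : Graph n → Subset n → Graph n
G [ X ] = record
  { V        = V G ∩ X
  ; _~_      = λ u v → G ⊢ u ~ v × u ∈ X × v ∈ X
  ; _~?_     = λ u v → (u ~? v) ×-dec (u ∈? X) ×-dec (v ∈? X)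
  ; ~-sym    = λ (e , u∈ , v∈) → ~-sym e , v∈ , u∈
  ; ~-irrefl = λ (e , _) → ~-irrefl e
  ; ~⇒∈V     = λ (e , u∈ , _) → x∈p∩q⁺ (~⇒∈V e , u∈)
  }
  where open Graph G hiding (V)

_-ᴳ_ : Graph n → Subset n → Graph n
G -ᴳ S = G [ ∁ S ]

-- For vertices u and v of G: they lie in the same component of G.
Linked : Graph n → Fin n → Fin n → Set
Linked G = Star (Graph._~_ G)

Connected : Graph n → Set
Connected G = Nonempty (V G) × (∀ {u v} → u ∈ V G → v ∈ V G → Linked G u v)

-- A cycle c₀ c₁ … c₂₊ₖ c₀ of length 3 + k.
Cycle : Graph n → Set
Cycle {n} G = ∃[ k ] Σ (Fin (3 ℕ.+ k) → Fin n) λ c →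
    Injective _≡_ _≡_ c
  × (∀ i → G ⊢ c (inject₁ i) ~ c (suc i))
  × G ⊢ c (fromℕ (2 ℕ.+ k)) ~ c zero

IsTree : Graph n → Set
IsTree T = Connected T × ¬ Cycle T

_≅_ : Graph n → Graph m → Set
G ≅ H = Σ ((∃ λ u → u ∈ V G) ↔ (∃ λ x → x ∈ V H)) λ f →
  ∀ u v → (G ⊢ proj₁ u ~ proj₁ v) ⇔
          (H ⊢ proj₁ (Inverse.to f u) ~ proj₁ (Inverse.to f v))

GraphClass : (ℓ : Level) → Set (lsuc 0ℓ ⊔ˡ lsuc ℓ)
GraphClass ℓ = ∀ {n} → Graph n → Set ℓ

IsMaximum IsMinimum : (ℤ → Set a) → ℤ → Set a
IsMaximum P m = P m × (∀ j → P j → j ≤ m)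
IsMinimum P m = P m × (∀ j → P j → m ≤ j)

-- An invariant is a relation, "ρ G k" reading "ρ(G) = k", because a
-- minimum over the infinitely many tree decompositions of G has no
-- evident computation.  The value is unique and its existence is
-- classically provable, see `Defined` below.
Invariant : (a : Level) → Set (lsuc 0ℓ ⊔ˡ lsuc a)
Invariant a = ∀ {n} → Graph n → ℤ → Set a

_AtMost_ : (ℤ → Set a) → ℤ → Set a
value AtMost k = ∀ m → value m → m ≤ k

Bounded : Invariant a → GraphClass ℓ → Set (lsuc 0ℓ ⊔ˡ a ⊔ˡ ℓ)
Bounded ρ 𝒢 = ∃[ k ] (∀ {n} (G : Graph n) → 𝒢 G → ρ G AtMost k)

Independent : Graph n → Subset n → Set
Independent G S = S ⊆ V G × (∀ {u v} → u ∈ S → v ∈ S → ¬ G ⊢ u ~ v)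

IndependenceNumber : Invariant 0ℓ
IndependenceNumber G = IsMaximum λ k → ∃[ S ] (Independent G S × k ≡ + ∣ S ∣)

record TreeDecomposition (G : Graph n) : Set₁ where
  field
    {N}    : ℕ
    T      : Graph N
    isTree : IsTree T
    bag    : Fin N → Subset n

  nodesOf : Fin n → Subset N
  nodesOf u = tabulate λ t → lookup (bag t) u

  field
    bag⊆V     : ∀ {t} → t ∈ V T → bag t ⊆ V G
    vertices  : ∀ {u} → u ∈ V G → ∃[ t ] (t ∈ V T × u ∈ bag t)
    edges     : ∀ {u v} → G ⊢ u ~ v → ∃[ t ] (t ∈ V T × u ∈ bag t × v ∈ bag t)
    connected : ∀ {u} → u ∈ V G → Connected (T [ nodesOf u ])

module _ {G : Graph n} (𝒯 : TreeDecomposition G) where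
  open TreeDecomposition 𝒯

  Width : ℤ → Set
  Width w = ∃[ m ] (IsMaximum (λ k → ∃[ t ] (t ∈ V T × k ≡ + ∣ bag t ∣)) m × w ≡ m - 1ℤ)

  DecompositionIndependenceNumber : ℤ → Set
  DecompositionIndependenceNumber =
    IsMaximum λ k → ∃[ t ] (t ∈ V T × IndependenceNumber (G [ bag t ]) k)

-- The null graph has treewidth -1.
Treewidth : Invariant (lsuc 0ℓ)
Treewidth G = IsMinimum λ w → Σ (TreeDecomposition G) λ 𝒯 → Width 𝒯 w

TreeIndependenceNumber : Invariant (lsuc 0ℓ)
TreeIndependenceNumber G =
  IsMinimum λ k → Σ (TreeDecomposition G) λ 𝒯 → DecompositionIndependenceNumber 𝒯 k

IntersectionGraph : ∀ {p} → (Fin p → Graph n) → Graph p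
IntersectionGraph Hs = record
  { V        = ⊤
  ; _~_      = λ i j → i ≢ j × ∃[ x ] (x ∈ V (Hs i) × x ∈ V (Hs j))
  ; _~?_     = λ i j → ¬? (i ≟ᶠ j) ×-dec any? (λ x → (x ∈? V (Hs i)) ×-dec (x ∈? V (Hs j)))
  ; ~-sym    = λ (i≢j , x , x∈i , x∈j) → i≢j ∘ sym , x , x∈j , x∈i
  ; ~-irrefl = λ (i≢i , _) → i≢i refl
  ; ~⇒∈V     = λ _ → ∈⊤
  }

_RepresentableIn_ : Graph n → Graph m → Set₁
_RepresentableIn_ {m = m} G H = ∃[ p ] Σ (Fin p → Graph m) λ Hs →
  (∀ i → Hs i ⊆ᴳ H × Connected (Hs i)) × G ≅ IntersectionGraph Hs

IntersectionTreewidth : Invariant (lsuc 0ℓ)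
IntersectionTreewidth G = IsMinimum λ k →
  0ℤ ≤ k × ∃[ m ] Σ (Graph m) λ H → Treewidth H AtMost k × G RepresentableIn H

module _ (G : Graph n) where

  Separator : (u v : Fin n) → Subset n → Set
  Separator u v S = S ⊆ V G × u ∉ S × v ∉ S × ¬ Linked (G -ᴳ S) u v

  MinimalSeparatorOf : (u v : Fin n) → Subset n → Set
  MinimalSeparatorOf u v S = Separator u v S × (∀ {S′} → S′ ⊂ S → ¬ Separator u v S′)

  MinimalSeparator : Subset n → Set
  MinimalSeparator S = ∃[ u ] ∃[ v ]
    (u ∈ V G × v ∈ V G × u ≢ v × ¬ G ⊢ u ~ v × MinimalSeparatorOf u v S)

MaximumMinimalSeparatorSize : Invariant 0ℓ
MaximumMinimalSeparatorSize G = IsMinimum λ k →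
  0ℤ ≤ k × (∀ {S} → MinimalSeparator G S → + ∣ S ∣ ≤ k)

-- The values of the invariants are unique, and cannot fail to exist.
-- As _≤_ on ℤ is decidable, "ρ G AtMost k" is therefore equivalent to
-- ¬ ¬ ∃[ m ] (ρ G m × m ≤ k).

module _ {P : ℤ → Set a} where

  maximum-unique : ∀ {i j} → IsMaximum P i → IsMaximum P j → i ≡ j
  maximum-unique (Pi , i-max) (Pj , j-max) = ℤ.≤-antisym (j-max _ Pi) (i-max _ Pj)

  minimum-unique : ∀ {i j} → IsMinimum P i → IsMinimum P j → i ≡ j
  minimum-unique (Pi , i-min) (Pj , j-min) = ℤ.≤-antisym (i-min _ Pj) (j-min _ Pi)

pred-shift : ∀ b d → ℤ.pred (b ℤ.+ (+ suc d)) ≡ b ℤ.+ (+ d)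
pred-shift b d = trans (sym (ℤ.+-assoc -1ℤ b (+ suc d)))
  (trans (cong (ℤ._+ (+ suc d)) (ℤ.+-comm -1ℤ b)) (ℤ.+-assoc b -1ℤ (+ suc d)))

split : ∀ {b k} → b ≤ k → k ≤ b ℤ.+ (+ ℤ.∣ k - b ∣)
split {b} {k} b≤k = ℤ.≤-reflexive (sym
  (trans (cong (λ x → b ℤ.+ x) (trans (ℤ.0≤i⇒+∣i∣≡i (ℤ.i≤j⇒0≤j-i b≤k)) (ℤ.+-comm k (- b))))
  (trans (sym (ℤ.+-assoc b (- b) k))
  (trans (cong (ℤ._+ k) (ℤ.+-inverseʳ b)) (ℤ.+-identityˡ k)))))

minimum-exists : {P : ℤ → Set a} (b : ℤ) → (∀ {j} → P j → b ≤ j) → ∃ P → ¬ ¬ ∃ (IsMinimum P)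
minimum-exists {P = P} b below (k , Pk) = go ℤ.∣ k - b ∣ k Pk (split (below Pk))
  where
  go : ∀ d k → P k → k ≤ b ℤ.+ (+ d) → ¬ ¬ ∃ (IsMinimum P)
  go zero    k Pk k≤ none = none (k , Pk , λ _ Pj →
    ℤ.≤-trans k≤ (ℤ.≤-trans (ℤ.≤-reflexive (ℤ.+-identityʳ b)) (below Pj)))
  go (suc d) k Pk k≤ none = none (k , Pk , least)
    where
    least : ∀ j → P j → k ≤ j
    least j Pj with k ℤ.≤? j
    ... | yes k≤j = k≤j
    ... | no  k≰j = contradiction none (go d j Pj (ℤ.≤-trans
      (ℤ.i<j⇒i≤pred[j] (ℤ.≰⇒> k≰j))
      (ℤ.≤-trans (ℤ.pred-mono k≤) (ℤ.≤-reflexive (pred-shift b d)))))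

maximum-exists : {P : ℤ → Set a} (b : ℤ) → (∀ {j} → P j → j ≤ b) → ∃ P → ¬ ¬ ∃ (IsMaximum P)
maximum-exists {P = P} b above (k , Pk) none =
  minimum-exists {P = P ∘ -_} (- b) (λ {j} Pj → flip- j (above Pj)) (- k , reneg Pk)
    λ (m , Pm , least) → none (- m , Pm , λ j Pj →
      subst (_≤ - m) (ℤ.neg-involutive j) (ℤ.neg-mono-≤ (least _ (reneg Pj))))
  where
  flip- : ∀ j → - j ≤ b → - b ≤ j
  flip- j -j≤b = subst (- b ≤_) (ℤ.neg-involutive j) (ℤ.neg-mono-≤ -j≤b)
  reneg : ∀ {j} → P j → P (- - j)
  reneg {j} = subst P (sym (ℤ.neg-involutive j))

-- Uniqueness holds for every invariant below by minimum-unique and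
-- maximum-unique.
Defined : Invariant a → Set (lsuc 0ℓ ⊔ˡ a)
Defined ρ = ∀ {n} (G : Graph n) → ¬ ¬ ∃ (ρ G)

independenceNumber-defined : Defined IndependenceNumber
independenceNumber-defined {n} G = maximum-exists (+ n)
  (λ { (S , _ , refl) → +≤+ (∣p∣≤n S) })
  (+ ∣ ∅ {n} ∣ , ∅ , independent-∅ , refl)
  where
  independent-∅ : Independent G ∅
  independent-∅ = (λ x∈ → contradiction x∈ ∉⊥) , λ u∈ → contradiction u∈ ∉⊥

point : Graph 1
point = record
  { V = ⊤ ; _~_ = λ _ _ → False ; _~?_ = λ _ _ → no λ ()
  ; ~-sym = λ () ; ~-irrefl = λ () ; ~⇒∈V = λ () }

∈-tabulate : {f : Fin n → Side} {x : Fin n} → f x ≡ inside → x ∈ tabulate f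
∈-tabulate {f = f} {x} eq = lookup⇒[]= x _ (trans (lookup∘tabulate f x) eq)

oneBag : (G : Graph n) → TreeDecomposition G
oneBag G = record
  { T         = point
  ; isTree    = ((zero , here) , λ { {zero} {zero} _ _ → ε }) , λ ()
  ; bag       = λ _ → V G
  ; bag⊆V     = λ _ u∈ → u∈
  ; vertices  = λ u∈ → zero , here , u∈
  ; edges     = λ e → zero , here , Graph.~⇒∈V G e , Graph.~⇒∈V G (Graph.~-sym G e)
  ; connected = λ {u} u∈ → (zero , x∈p∩q⁺ (here , ∈-tabulate {f = λ _ → lookup (V G) u} ([]=⇒lookup u∈))) , λ { {zero} {zero} _ _ → ε }
  }

module _ {G : Graph n} (𝒯 : TreeDecomposition G) where
  open TreeDecomposition 𝒯

  private
    t₀ : Nonempty (V T)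
    t₀ = proj₁ (proj₁ isTree)

  width-exists : ¬ ¬ ∃ (Width 𝒯)
  width-exists none = maximum-exists (+ n)
    (λ { (t , _ , refl) → +≤+ (∣p∣≤n (bag t)) })
    (_ , proj₁ t₀ , proj₂ t₀ , refl)
    λ (m , max) → none (_ , m , max , refl)

  decompositionIndependenceNumber-exists : ¬ ¬ ∃ (DecompositionIndependenceNumber 𝒯)
  decompositionIndependenceNumber-exists none =
    independenceNumber-defined (G [ bag (proj₁ t₀) ]) λ (k , α) → maximum-exists (+ n)
      (λ { (t , _ , (S , _ , refl) , _) → +≤+ (∣p∣≤n S) })
      (k , proj₁ t₀ , proj₂ t₀ , α)
      none

treewidth-defined : Defined Treewidth
treewidth-defined G none = width-exists (oneBag G) λ (w , width) → minimum-exists -1ℤ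
  (λ { (𝒯 , _ , ((t , _ , refl) , _) , refl) →
    ℤ.+-monoˡ-≤ -1ℤ {0ℤ} {+ ∣ TreeDecomposition.bag 𝒯 t ∣} (+≤+ z≤n) })
  (w , oneBag G , width)
  none

treeIndependenceNumber-defined : Defined TreeIndependenceNumber
treeIndependenceNumber-defined G none =
  decompositionIndependenceNumber-exists (oneBag G) λ (k , α) → minimum-exists 0ℤ
    (λ { (_ , (_ , _ , (S , _ , refl) , _) , _) → +≤+ z≤n })
    (k , oneBag G , α)
    none

maximumMinimalSeparatorSize-defined : Defined MaximumMinimalSeparatorSize
maximumMinimalSeparatorSize-defined {n} G = minimum-exists 0ℤ proj₁
  (+ n , +≤+ z≤n , λ {S} _ → +≤+ (∣p∣≤n S))

complete : (m : ℕ) → Graph m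
complete m = record
  { V = ⊤ ; _~_ = _≢_ ; _~?_ = λ u v → ¬? (u ≟ᶠ v)
  ; ~-sym = λ u≢v → u≢v ∘ sym ; ~-irrefl = λ u≢u → u≢u refl ; ~⇒∈V = λ _ → ∈⊤ }

complete-connected : {X : Subset m} → Nonempty X → Connected (complete m [ X ])
complete-connected {X = X} (x , x∈X) = (x , x∈p∩q⁺ (∈⊤ , x∈X)) , link
  where
  link : ∀ {u v} → u ∈ ⊤ ∩ X → v ∈ ⊤ ∩ X → Linked (complete _ [ X ]) u v
  link {u} {v} u∈ v∈ with u ≟ᶠ v
  ... | yes refl = ε
  ... | no  u≢v  = (u≢v , proj₂ (x∈p∩q⁻ ⊤ X u∈) , proj₂ (x∈p∩q⁻ ⊤ X v∈)) ◅ ε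

module _ {P : Fin n → Set} (P? : U.Decidable P) where
  comprehension : Subset n
  comprehension = tabulate λ x → ⌊ P? x ⌋

  ∈-comprehension⁺ : ∀ {x} → P x → x ∈ comprehension
  ∈-comprehension⁺ {x} Px = ∈-tabulate holds
    where
    holds : ⌊ P? x ⌋ ≡ inside
    holds with P? x
    ... | yes _  = refl
    ... | no ¬Px = contradiction Px ¬Px

  ∈-comprehension⁻ : ∀ {x} → x ∈ comprehension → P x
  ∈-comprehension⁻ {x} x∈ with P? x | trans (sym (lookup∘tabulate (λ y → ⌊ P? y ⌋) x)) ([]=⇒lookup x∈)
  ... | yes Px | _  = Px
  ... | no  _  | ()

index : {X : Subset n} {u : Fin n} → u ∈ X → Fin ∣ X ∣
index {X = inside  ∷ _} here       = zero
index {X = inside  ∷ _} (there u∈) = suc (index u∈)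
index {X = outside ∷ _} (there u∈) = index u∈

element : (X : Subset n) → Fin ∣ X ∣ → ∃ (_∈ X)
element (inside  ∷ X) zero    = zero , here
element (inside  ∷ X) (suc i) = let u , u∈ = element X i in suc u , there u∈
element (outside ∷ X) i       = let u , u∈ = element X i in suc u , there u∈

index-element : (X : Subset n) (i : Fin ∣ X ∣) → index (proj₂ (element X i)) ≡ i
index-element (inside  ∷ X) zero    = refl
index-element (inside  ∷ X) (suc i) = cong suc (index-element X i)
index-element (outside ∷ X) i       = index-element X i

element-index : {X : Subset n} {u : Fin n} (u∈ : u ∈ X) → element X (index u∈) ≡ (u , u∈)
element-index {X = inside  ∷ _} here       = refl
element-index {X = inside  ∷ _} (there u∈) = cong (λ (u , u∈) → suc u , there u∈) (element-index u∈)
element-index {X = outside ∷ _} (there u∈) = cong (λ (u , u∈) → suc u , there u∈) (element-index u∈)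

-- Each vertex u is represented by the set of all pairs (u , u), (u , w)
-- and (w , u) with w adjacent to u, in the complete graph on all pairs.
representable : (G : Graph n) → G RepresentableIn complete (n ℕ.* n)
representable {n} G = ∣ V G ∣ , sub ∘ vertex , (λ i → sub⊆ (vertex i) , sub-connected (vertex i)) ,
  iso , λ (u , u∈) (v , v∈) → mk⇔ (forth u∈ v∈) (back u∈ v∈)
  where
  open Graph G hiding (V)

  vertex : Fin ∣ V G ∣ → Fin n
  vertex i = proj₁ (element (V G) i)

  vertex-index : ∀ {u} (u∈ : u ∈ V G) → vertex (index u∈) ≡ u
  vertex-index u∈ = cong proj₁ (element-index u∈)

  At : Fin n → Fin n × Fin n → Set
  At u (i , j) = (u ≡ i ⊎ u ≡ j) × (i ≡ j ⊎ i ~ j)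

  at? : ∀ u x → Dec (At u (remQuot n x))
  at? u x = let i , j = remQuot {n} n x in ((u ≟ᶠ i) ⊎-dec (u ≟ᶠ j)) ×-dec ((i ≟ᶠ j) ⊎-dec (i ~? j))

  star : Fin n → Subset (n ℕ.* n)
  star u = comprehension (at? u)

  ∈-star : ∀ {u i j} → At u (i , j) → combine i j ∈ star u
  ∈-star {u} {i} {j} at = ∈-comprehension⁺ (at? u) (subst (At u) (sym (remQuot-combine i j)) at)

  sub : Fin n → Graph (n ℕ.* n)
  sub u = complete (n ℕ.* n) [ star u ]

  sub⊆ : ∀ u → sub u ⊆ᴳ complete (n ℕ.* n)
  sub⊆ u = (λ _ → ∈⊤) , proj₁

  sub-connected : ∀ u → Connected (sub u)
  sub-connected u = complete-connected (combine u u , ∈-star (inj₁ refl , inj₁ refl))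

  iso : ∃ (_∈ V G) ↔ ∃ (λ (i : Fin ∣ V G ∣) → i ∈ ⊤)
  iso = mk↔ₛ′ (λ (u , u∈) → index u∈ , ∈⊤) (λ (i , _) → element (V G) i)
    (λ (i , i∈) → pair (index-element (V G) i)) (λ (u , u∈) → element-index u∈)
    where
    pair : ∀ {i j : Fin ∣ V G ∣} {p : i ∈ ⊤} {q : j ∈ ⊤} → i ≡ j → (i , p) ≡ (j , q)
    pair {i} {p = p} {q} refl = cong (i ,_) ([]=-irrelevant p q)

  I : Graph ∣ V G ∣
  I = IntersectionGraph (sub ∘ vertex)

  forth : ∀ {u v} (u∈ : u ∈ V G) (v∈ : v ∈ V G) → u ~ v → I ⊢ index u∈ ~ index v∈
  forth {u} {v} u∈ v∈ u~v = distinct , combine u v , meets u∈ (inj₁ refl) , meets v∈ (inj₂ refl)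
    where
    distinct : index u∈ ≢ index v∈
    distinct eq = ~-irrefl (subst (u ~_)
      (trans (sym (vertex-index v∈)) (trans (cong vertex (sym eq)) (vertex-index u∈))) u~v)
    meets : ∀ {w} (w∈ : w ∈ V G) → w ≡ u ⊎ w ≡ v → combine u v ∈ V (sub (vertex (index w∈)))
    meets w∈ end = x∈p∩q⁺ (∈⊤ , ∈-star (subst (λ w → At w (u , v)) (sym (vertex-index w∈)) (end , inj₂ u~v)))

  adjacent : ∀ {u v p} → u ≢ v → At u p → At v p → u ~ v
  adjacent u≢v (inj₁ refl , _) (inj₁ refl , _)       = contradiction refl u≢v
  adjacent u≢v (inj₂ refl , _) (inj₂ refl , _)       = contradiction refl u≢v
  adjacent u≢v (inj₁ refl , inj₁ refl) (inj₂ refl , _) = contradiction refl u≢v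
  adjacent u≢v (inj₁ refl , inj₂ e) (inj₂ refl , _)  = e
  adjacent u≢v (inj₂ refl , inj₁ refl) (inj₁ refl , _) = contradiction refl u≢v
  adjacent u≢v (inj₂ refl , inj₂ e) (inj₁ refl , _)  = ~-sym e

  back : ∀ {u v} (u∈ : u ∈ V G) (v∈ : v ∈ V G) → I ⊢ index u∈ ~ index v∈ → u ~ v
  back {u} {v} u∈ v∈ (i≢j , x , x∈u , x∈v) = adjacent u≢v (at u∈ x∈u) (at v∈ x∈v)
    where
    u≢v : u ≢ v
    u≢v refl = i≢j (cong index ([]=-irrelevant u∈ v∈))
    at : ∀ {w} (w∈ : w ∈ V G) → x ∈ V (sub (vertex (index w∈))) → At w (remQuot n x)
    at w∈ x∈ = subst (λ w → At w (remQuot n x)) (vertex-index w∈)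
      (∈-comprehension⁻ (at? _) (proj₂ (x∈p∩q⁻ ⊤ _ x∈)))

intersectionTreewidth-defined : Defined IntersectionTreewidth
intersectionTreewidth-defined {n} G none = treewidth-defined (complete (n ℕ.* n)) λ (w , tw) →
  minimum-exists 0ℤ proj₁
    ( 0ℤ ℤ.⊔ w , ℤ.i≤i⊔j 0ℤ w , n ℕ.* n , complete (n ℕ.* n)
    , (λ _ tw′ → subst (_≤ 0ℤ ℤ.⊔ w) (minimum-unique tw tw′) (ℤ.i≤j⊔i 0ℤ w))
    , representable G )
    none

{-# OPTIONS --safe #-}
module Submission where

-- In each case one exhibits a tree decomposition all of whose bags have
-- small independence number.  For intersection treewidth, replace each
-- bag X of a decomposition of H by the set of vertices whose subgraph
-- meets X; an independent subset injects into X.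
--
-- For minimal separators of size at most k: if D and A are connected,
-- disjoint and anticomplete, and N(D) ⊆ N(A) ("D is backed by A"), then
-- N(D) is a minimal separator, so |N(D)| ≤ k.  Given a backed component C
-- of the part not yet decomposed, consider sets Ω with
-- N(C) ⊆ Ω ⊆ N(C) ∪ C such that every component of G - Ω is backed, for
-- instance N(C) ∪ C.  If x, y ∈ Ω are separated by Ω ∖ {x , y}, a minimal
-- separator T inside that set has a full component contained in C, and
-- that component can be removed from Ω.  When no such pair is left, any
-- two non-adjacent x, y ∈ Ω are both attached to a common component of
-- G - Ω.  The set Ω becomes the next bag, attached to one containing N(C).
--
-- Let I ⊆ Ω be independent, x, y ∈ I distinct, and T a minimal
-- x,y-separator.  Every other z ∈ I lies in T or is attached to a
-- component of G - Ω meeting T, since otherwise x and y are linked through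
-- z; as T and these attachments have size at most k, |I| ≤ (k + 2)(k + 1).

open import Defs
open import Data.Empty renaming (⊥ to False) using ()
open import Data.Fin.Base using (Fin; zero; suc; inject₁; fromℕ; combine; inject≤)
open import Data.Fin.Properties using (any?; suc-injective; injective⇒≤; combine-injective; inject≤-injective) renaming (_≟_ to _≟ᶠ_)
open import Data.Fin.Relation.Unary.Top using (view; ‵fromℕ; ‵inject₁)
open import Data.Fin.Subset using (Subset; inside; outside; _∈_; _∉_; _⊆_; _⊂_; _∩_; _∪_; ∁; ⁅_⁆; ∣_∣; Nonempty; Empty) renaming (⊥ to ∅)
open import Data.Fin.Subset.Induction using (Acc; acc; ⊂-wellFounded; ⊃-wellFounded)
open import Data.Fin.Subset.Properties using (_∈?_; _⊆?_; _⊂?_; anySubset?; nonempty?; Empty-unique; ∉⊥; ∣⊥∣≡0; x∈⁅x⁆; x∈⁅y⁆⇒x≡y; ∣⁅x⁆∣≡1; ⊆-antisym; p⊆q⇒∣p∣≤∣q∣; x∈∁p⇒x∉p; x∉p⇒x∈∁p; x∈p∩q⁺; x∈p∩q⁻; x∈p∪q⁺; x∈p∪q⁻; p⊆p∪q)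
open import Data.Integer.Base using (ℤ; +_; +≤+)
import Data.Integer.Base as ℤ
import Data.Integer.Properties as ℤ
open import Data.Nat.Base using (ℕ; zero; suc; _+_; _*_; _≤_; z≤n; s≤s)
import Data.Nat.Properties as ℕ
open import Data.Product using (Σ; ∃; ∃-syntax; _×_; _,_; proj₁; proj₂)
open import Data.Sum.Base using (_⊎_; inj₁; inj₂; [_,_]′)
open import Data.Vec.Base using ([]; _∷_; lookup; tabulate; here; there)
open import Data.Vec.Properties using ([]=⇒lookup; lookup⇒[]=; lookup∘tabulate)
open import Data.Vec.Properties.WithK using ([]=-irrelevant)
open import Function.Base using (_∘_; id)
open import Function.Bundles using (_↔_; _⇔_; module Inverse; module Equivalence; module Injection)
open import Function.Properties.Inverse using (↔⇒↣)
open import Level using (Level)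
open import Relation.Binary.Construct.Closure.ReflexiveTransitive using (ε; _◅_; _◅◅_)
import Relation.Binary.Construct.Closure.ReflexiveTransitive as Star
open import Relation.Binary.PropositionalEquality using (_≡_; _≢_; refl; sym; trans; cong; cong₂; subst)
open import Relation.Nullary using (¬_; Dec; yes; no)
open import Relation.Nullary.Decidable using (_×-dec_; ¬?; decidable-stable; map′)
open import Relation.Nullary.Negation using (contradiction)

private variable
  n m N k : ℕ

-- Cardinalities of subsets through injections into `Fin`.

index-injective : {X : Subset n} {u v : Fin n} (u∈X : u ∈ X) (v∈X : v ∈ X) →
  index u∈X ≡ index v∈X → u ≡ v
index-injective {X = X} u∈X v∈X eq = trans (sym (cong proj₁ (element-index u∈X)))
  (trans (cong (proj₁ ∘ element X) eq) (cong proj₁ (element-index v∈X)))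

element-injective : (X : Subset n) {i j : Fin ∣ X ∣} →
  proj₁ (element X i) ≡ proj₁ (element X j) → i ≡ j
element-injective X {i} {j} eq = trans (sym (index-element X i))
  (trans (index-cong (proj₂ (element X i)) (proj₂ (element X j)) eq) (index-element X j))
  where
  index-cong : ∀ {u v} (u∈X : u ∈ X) (v∈X : v ∈ X) → u ≡ v → index u∈X ≡ index v∈X
  index-cong u∈X v∈X refl = cong index ([]=-irrelevant u∈X v∈X)

∣∣-injection : {X : Subset n} {k : ℕ} (f : ∀ {u} → u ∈ X → Fin k) →
  (∀ {u v} (u∈X : u ∈ X) (v∈X : v ∈ X) → f u∈X ≡ f v∈X → u ≡ v) → ∣ X ∣ ≤ k
∣∣-injection {X = X} f f-injective = injective⇒≤ {f = λ i → f (proj₂ (element X i))} λ {i} {j} eq →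
  element-injective X (f-injective (proj₂ (element X i)) (proj₂ (element X j)) eq)

-- A union bound: an element is coded by the index in `T` of a set that covers it, paired with its
-- position inside that set.
∣∣-cover : {X T : Subset n} {b : ℕ} {F : Fin n → Subset n} →
  (∀ {t} → t ∈ T → ∣ F t ∣ ≤ b) →
  (∀ {u} → u ∈ X → ∃[ t ] (t ∈ T × u ∈ F t)) → ∣ X ∣ ≤ ∣ T ∣ * b
∣∣-cover {X = X} {T} {b} {F} small cover = ∣∣-injection
  (λ u∈X → let _ , t∈T , u∈Ft = cover u∈X in place t∈T u∈Ft)
  λ u∈X v∈X eq → let _ , t∈T , u∈Ft = cover u∈X ; _ , s∈T , v∈Fs = cover v∈X in
    place-injective t∈T s∈T u∈Ft v∈Fs eq
  where
  place : ∀ {u t} → t ∈ T → u ∈ F t → Fin (∣ T ∣ * b)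
  place t∈T u∈Ft = combine (index t∈T) (inject≤ (index u∈Ft) (small t∈T))

  place-injective : ∀ {u v t s} (t∈T : t ∈ T) (s∈T : s ∈ T) (u∈Ft : u ∈ F t) (v∈Fs : v ∈ F s) →
    place t∈T u∈Ft ≡ place s∈T v∈Fs → u ≡ v
  place-injective t∈T s∈T u∈Ft v∈Fs eq
    with t≡s , u≡v ← combine-injective (index t∈T) _ (index s∈T) _ eq
    -- Only after `t` and `s` are identified do the two positions refer to the same set.
    with refl ← index-injective t∈T s∈T t≡s =
    index-injective u∈Ft v∈Fs (inject≤-injective (small t∈T) (small s∈T) _ _ u≡v)

∣p∪q∣≤∣p∣+∣q∣ : (p q : Subset n) → ∣ p ∪ q ∣ ≤ ∣ p ∣ + ∣ q ∣
∣p∪q∣≤∣p∣+∣q∣ [] [] = z≤n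
∣p∪q∣≤∣p∣+∣q∣ (inside  ∷ p) (inside  ∷ q) = s≤s (ℕ.≤-trans (∣p∪q∣≤∣p∣+∣q∣ p q)
  (ℕ.+-monoʳ-≤ ∣ p ∣ (ℕ.n≤1+n ∣ q ∣)))
∣p∪q∣≤∣p∣+∣q∣ (inside  ∷ p) (outside ∷ q) = s≤s (∣p∪q∣≤∣p∣+∣q∣ p q)
∣p∪q∣≤∣p∣+∣q∣ (outside ∷ p) (inside  ∷ q) = ℕ.≤-trans (s≤s (∣p∪q∣≤∣p∣+∣q∣ p q))
  (ℕ.≤-reflexive (sym (ℕ.+-suc ∣ p ∣ ∣ q ∣)))
∣p∪q∣≤∣p∣+∣q∣ (outside ∷ p) (outside ∷ q) = ∣p∪q∣≤∣p∣+∣q∣ p q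

-- From values of invariants to explicit bounds.

IndependenceBounded : Graph n → ℕ → Subset n → Set
IndependenceBounded G k X = ∀ {I} → Independent G I → I ⊆ X → ∣ I ∣ ≤ k

-- The independence number of `𝒯` is available only under a double negation. This suffices, because
-- the goal is a decidable comparison of integers.
treeIndependenceNumber≤ : {G : Graph n} {k : ℕ} (𝒯 : TreeDecomposition G) → let open TreeDecomposition 𝒯 in
  (∀ {t} → t ∈ V T → IndependenceBounded G k (bag t)) → TreeIndependenceNumber G AtMost (+ k)
treeIndependenceNumber≤ {G = G} {k} 𝒯 bounded m (_ , least) = decidable-stable (m ℤ.≤? + k) λ m≰k →
  decompositionIndependenceNumber-exists 𝒯 λ (j , α) → m≰k (ℤ.≤-trans (least j (𝒯 , α)) (bound α))
  where
  open TreeDecomposition 𝒯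
  bound : ∀ {j} → DecompositionIndependenceNumber 𝒯 j → j ℤ.≤ + k
  bound ((t , t∈T , (I , (I⊆ , no-edge) , refl) , _) , _) = +≤+ (bounded t∈T
    ((λ u∈I → proj₁ (x∈p∩q⁻ _ _ (I⊆ u∈I))) , λ u∈I v∈I e → no-edge u∈I v∈I
      (e , proj₂ (x∈p∩q⁻ _ _ (I⊆ u∈I)) , proj₂ (x∈p∩q⁻ _ _ (I⊆ v∈I))))
    λ u∈I → proj₂ (x∈p∩q⁻ _ _ (I⊆ u∈I)))

-- Upper bounds may be proved classically, so optimal decompositions can be assumed to exist.
AtMost-stable : {a : Level} {P : ℤ → Set a} {k : ℤ} → ¬ ¬ (P AtMost k) → P AtMost k
AtMost-stable {k = k} ¬¬bound m Pm = decidable-stable (m ℤ.≤? k) λ m≰k → ¬¬bound λ bound → m≰k (bound m Pm)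

i≤+∣i∣ : (i : ℤ) → i ℤ.≤ + ℤ.∣ i ∣
i≤+∣i∣ (+ _)        = ℤ.≤-refl
i≤+∣i∣ ℤ.-[1+ _ ] = ℤ.-≤+

-- The bound of a class is an integer, possibly negative; the quantitative lemmas below take a
-- natural number.
AtMost-∣∣ : {a : Level} {P : ℤ → Set a} {k : ℤ} → P AtMost k → P AtMost (+ ℤ.∣ k ∣)
AtMost-∣∣ {k = k} bound m Pm = ℤ.≤-trans (bound m Pm) (i≤+∣i∣ k)

independenceBounded : {G : Graph n} {k : ℕ} → IndependenceNumber G AtMost (+ k) →
  IndependenceBounded G k (V G)
independenceBounded {G = G} {k} bound {I} independent _ = decidable-stable (∣ I ∣ ℕ.≤? k) λ I≰k →
  independenceNumber-defined G λ (m , α) →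
    I≰k (ℤ.drop‿+≤+ (ℤ.≤-trans (proj₂ α _ (I , independent , refl)) (bound m α)))

-- The decomposition is one that attains the treewidth; `suc k` undoes the subtraction of one in
-- `Width`.
smallBags : {G : Graph n} {k : ℕ} → Treewidth G AtMost (+ k) →
  ¬ ¬ Σ (TreeDecomposition G) λ 𝒯 → let open TreeDecomposition 𝒯 in ∀ {t} → t ∈ V T → ∣ bag t ∣ ≤ suc k
smallBags {G = G} {k} bound none = treewidth-defined G λ { (w , tw@((𝒯 , m , (_ , largest) , refl) , _)) →
  none (𝒯 , λ {t} t∈T → drop-pred (ℤ.≤-trans (ℤ.+-monoˡ-≤ ℤ.-1ℤ (largest _ (t , t∈T , refl))) (bound w tw))) }
  where
  drop-pred : ∀ {b} → (+ b) ℤ.- ℤ.1ℤ ℤ.≤ + k → b ≤ suc k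
  drop-pred {zero}  _    = z≤n
  drop-pred {suc b} b≤k = s≤s (ℤ.drop‿+≤+ b≤k)

-- This agrees with `nodesOf`, but makes sense before the bags are known to form a decomposition.
nodes : (Fin N → Subset n) → Fin n → Subset N
nodes bag u = tabulate λ t → lookup (bag t) u

module _ (bag : Fin N → Subset n) where

  ∈-nodes⁺ : ∀ {t u} → u ∈ bag t → t ∈ nodes bag u
  ∈-nodes⁺ {t} {u} u∈t = ∈-tabulate {f = λ t → lookup (bag t) u} ([]=⇒lookup u∈t)

  ∈-nodes⁻ : ∀ {t u} → t ∈ nodes bag u → u ∈ bag t
  ∈-nodes⁻ {t} {u} t∈ = lookup⇒[]= u (bag t)
    (trans (sym (lookup∘tabulate (λ t → lookup (bag t) u) t)) ([]=⇒lookup t∈))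

-- Transferring a decomposition of the host graph along a representation.

module _ {G : Graph n} {H : Graph m} (rep : G RepresentableIn H)
         (𝒯 : TreeDecomposition H) where
  private
    open module 𝒯 = TreeDecomposition 𝒯 using (T)
    module G = Graph G

    Hs : Fin (proj₁ rep) → Graph m
    Hs = proj₁ (proj₂ rep)

    Hs⊆H : ∀ i → Hs i ⊆ᴳ H × Connected (Hs i)
    Hs⊆H = proj₁ (proj₂ (proj₂ rep))

    iso : ∃ (_∈ V G) ↔ ∃ (_∈ V (IntersectionGraph Hs))
    iso = proj₁ (proj₂ (proj₂ (proj₂ rep)))

    adj : ∀ u v → (G ⊢ proj₁ u ~ proj₁ v) ⇔
      (IntersectionGraph Hs ⊢ proj₁ (Inverse.to iso u) ~ proj₁ (Inverse.to iso v))
    adj = proj₂ (proj₂ (proj₂ (proj₂ rep)))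

    trace : ∀ {u} → u ∈ V G → Subset m
    trace {u} u∈G = V (Hs (proj₁ (Inverse.to iso (u , u∈G))))

    Meets : Fin 𝒯.N → Fin n → Set
    Meets t u = Σ (u ∈ V G) λ u∈G → ∃[ x ] (x ∈ trace u∈G × x ∈ 𝒯.bag t)

    meets? : ∀ t u → Dec (Meets t u)
    meets? t u with u ∈? V G
    ... | no  u∉G = no (u∉G ∘ proj₁)
    ... | yes u∈G = map′ (u∈G ,_)
      (λ (u∈G′ , x , x∈ , x∈t) → x , subst (λ u∈ → x ∈ trace u∈) ([]=-irrelevant u∈G′ u∈G) x∈ , x∈t)
      (any? λ x → (x ∈? trace u∈G) ×-dec (x ∈? 𝒯.bag t))

    bag : Fin 𝒯.N → Subset n
    bag t = comprehension (meets? t)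

    ∈bag⁺ : ∀ {t u x} (u∈G : u ∈ V G) → x ∈ trace u∈G → x ∈ 𝒯.bag t → u ∈ bag t
    ∈bag⁺ {t} u∈G x∈ x∈t = ∈-comprehension⁺ (meets? t) (u∈G , _ , x∈ , x∈t)

    ∈bag⁻ : ∀ {t u} → u ∈ bag t → Meets t u
    ∈bag⁻ {t} = ∈-comprehension⁻ (meets? t)

    trace⊆H : ∀ {u} (u∈G : u ∈ V G) → trace u∈G ⊆ V H
    trace⊆H u∈G = proj₁ (proj₁ (Hs⊆H _))

    module _ {u} (u∈G : u ∈ V G) where
      link-point : ∀ {x t s} → x ∈ trace u∈G → t ∈ V T → x ∈ 𝒯.bag t → s ∈ V T → x ∈ 𝒯.bag s →
        Linked (T [ nodes bag u ]) t s
      link-point {x} x∈ t∈T x∈t s∈T x∈s = Star.map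
        (λ (e , a∈ , b∈) → e , ∈-nodes⁺ bag (∈bag⁺ u∈G x∈ (∈-nodes⁻ 𝒯.bag a∈)) , ∈-nodes⁺ bag (∈bag⁺ u∈G x∈ (∈-nodes⁻ 𝒯.bag b∈)))
        (proj₂ (𝒯.connected (trace⊆H u∈G x∈))
          (x∈p∩q⁺ (t∈T , ∈-nodes⁺ 𝒯.bag x∈t)) (x∈p∩q⁺ (s∈T , ∈-nodes⁺ 𝒯.bag x∈s)))

      -- Nodes whose bags contain a fixed `x` are linked by `link-point`. Consecutive vertices of a
      -- walk in the subgraph of `u` share a bag `r`, and the pieces are joined at these nodes.
      link-path : ∀ {x y t s} → Linked (Hs (proj₁ (Inverse.to iso (u , u∈G)))) x y → x ∈ trace u∈G →
        t ∈ V T → x ∈ 𝒯.bag t → s ∈ V T → y ∈ 𝒯.bag s → Linked (T [ nodes bag u ]) t s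
      link-path ε x∈ t∈T x∈t s∈T x∈s = link-point x∈ t∈T x∈t s∈T x∈s
      link-path (e ◅ path) x∈ t∈T x∈t s∈T y∈s =
        let r , r∈T , x∈r , z∈r = 𝒯.edges (proj₂ (proj₁ (Hs⊆H _)) e)
            z∈ = Graph.~⇒∈V (Hs _) (Graph.~-sym (Hs _) e)
        in link-point x∈ t∈T x∈t r∈T x∈r ◅◅ link-path path z∈ r∈T z∈r s∈T y∈s

    vertices : ∀ {u} → u ∈ V G → ∃[ t ] (t ∈ V T × u ∈ bag t)
    vertices u∈G =
      let x , x∈ = proj₁ (proj₂ (Hs⊆H _))
          t , t∈T , x∈t = 𝒯.vertices (trace⊆H u∈G x∈)
      in t , t∈T , ∈bag⁺ u∈G x∈ x∈t

    shared : ∀ {u v} (u∈G : u ∈ V G) (v∈G : v ∈ V G) → G ⊢ u ~ v →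
      ∃[ x ] (x ∈ trace u∈G × x ∈ trace v∈G)
    shared u∈G v∈G e = proj₂ (Equivalence.to (adj (_ , u∈G) (_ , v∈G)) e)

    to-injective : ∀ {u v} (u∈G : u ∈ V G) (v∈G : v ∈ V G) →
      proj₁ (Inverse.to iso (u , u∈G)) ≡ proj₁ (Inverse.to iso (v , v∈G)) → u ≡ v
    to-injective u∈G v∈G eq = cong proj₁ (Injection.injective (↔⇒↣ iso) (pair eq))
      where
      pair : ∀ {a b : ∃ λ (i : Fin (proj₁ rep)) → i ∈ _} → proj₁ a ≡ proj₁ b → a ≡ b
      pair {a = a} refl = cong (proj₁ a ,_) ([]=-irrelevant _ _)

  representation-decomposition : TreeDecomposition G
  representation-decomposition = record
    { T         = T
    ; isTree    = 𝒯.isTree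
    ; bag       = bag
    ; bag⊆V     = λ _ u∈ → proj₁ (∈bag⁻ u∈)
    ; vertices  = vertices
    ; edges     = λ e →
        let u∈G = G.~⇒∈V e ; v∈G = G.~⇒∈V (G.~-sym e)
            x , x∈u , x∈v = shared u∈G v∈G e
            t , t∈T , x∈t = 𝒯.vertices (trace⊆H u∈G x∈u)
        in t , t∈T , ∈bag⁺ u∈G x∈u x∈t , ∈bag⁺ v∈G x∈v x∈t
    ; connected = λ u∈G →
        (let t , t∈T , u∈t = vertices u∈G in t , x∈p∩q⁺ (t∈T , ∈-nodes⁺ bag u∈t)) ,
        λ t∈ s∈ →
          let t∈T , t∈u = x∈p∩q⁻ _ _ t∈ ; s∈T , s∈u = x∈p∩q⁻ _ _ s∈
              u∈G , x , x∈ , x∈t = ∈bag⁻ (∈-nodes⁻ bag t∈u)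
              u∈G′ , y , y∈ , y∈s = ∈bag⁻ (∈-nodes⁻ bag s∈u)
          in link-path u∈G (proj₂ (proj₂ (Hs⊆H _)) x∈ (subst (λ u∈ → y ∈ trace u∈) ([]=-irrelevant u∈G′ u∈G) y∈))
               x∈ t∈T x∈t s∈T y∈s
    }

  -- Each member of `I` selects a vertex of the bag of `H` that lies in its own subgraph. If two
  -- members select the same vertex, their subgraphs meet, so independence forces their indices to
  -- agree.
  representation-independence : ∀ {t} → IndependenceBounded G ∣ 𝒯.bag t ∣ (TreeDecomposition.bag representation-decomposition t)
  representation-independence {t} {I} (I⊆G , no-edge) I⊆t = ∣∣-injection
    (λ u∈I → index (proj₂ (proj₂ (proj₂ (∈bag⁻ (I⊆t u∈I))))))
    λ u∈I v∈I eq →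
      let u∈G , _ , x∈u , x∈t = ∈bag⁻ (I⊆t u∈I) ; v∈G , _ , x∈v , y∈t = ∈bag⁻ (I⊆t v∈I)
      in to-injective u∈G v∈G (decidable-stable (_ ≟ᶠ _) λ i≢j →
           no-edge u∈I v∈I (Equivalence.from (adj (_ , u∈G) (_ , v∈G))
             (i≢j , _ , x∈u , subst (_∈ trace v∈G) (sym (index-injective x∈t y∈t eq)) x∈v)))

-- The cases of intersection treewidth, treewidth and independence number.

intersectionTreewidth⇒treeIndependenceNumber : {G : Graph n} {k : ℕ} →
  IntersectionTreewidth G AtMost (+ k) → TreeIndependenceNumber G AtMost (+ suc k)
intersectionTreewidth⇒treeIndependenceNumber {G = G} bound = AtMost-stable λ none →
  intersectionTreewidth-defined G λ { (w , itw@((_ , m , H , tw , rep) , _)) →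
    smallBags (λ j twj → ℤ.≤-trans (tw j twj) (bound w itw)) λ (𝒯 , small) →
      none (treeIndependenceNumber≤ (representation-decomposition rep 𝒯) λ t∈T independent I⊆t →
        ℕ.≤-trans (representation-independence rep 𝒯 independent I⊆t) (small t∈T)) }

treewidth⇒treeIndependenceNumber : {G : Graph n} {k : ℕ} →
  Treewidth G AtMost (+ k) → TreeIndependenceNumber G AtMost (+ suc k)
treewidth⇒treeIndependenceNumber bound = AtMost-stable λ none → smallBags bound λ (𝒯 , small) →
  none (treeIndependenceNumber≤ 𝒯 λ t∈T _ I⊆t → ℕ.≤-trans (p⊆q⇒∣p∣≤∣q∣ I⊆t) (small t∈T))

independenceNumber⇒treeIndependenceNumber : {G : Graph n} {k : ℕ} →
  IndependenceNumber G AtMost (+ k) → TreeIndependenceNumber G AtMost (+ k)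
independenceNumber⇒treeIndependenceNumber {G = G} bound =
  treeIndependenceNumber≤ (oneBag G) λ _ → independenceBounded {G = G} bound

-- Adding a leaf to a tree and a bag to a decomposition.

cycle-neighbours : (G : Graph n) ((k , c , _) : Cycle G) → ∀ i →
  ∃[ j ] ∃[ l ] (j ≢ l × G ⊢ c i ~ c j × G ⊢ c i ~ c l)
cycle-neighbours G (k , c , _ , step , close) zero =
  suc zero , fromℕ (2 + k) , (λ ()) , step zero , Graph.~-sym G close
cycle-neighbours G (k , c , _ , step , close) (suc i) with view i
-- After the last position the cycle returns to `zero`, which is not the preceding position because
-- the length is at least three.
... | ‵fromℕ     = inject₁ i , zero , (λ ()) , Graph.~-sym G (step i) , close
... | ‵inject₁ j = inject₁ i , suc (suc j) , skip j , Graph.~-sym G (step i) , step (suc j)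
  where
  skip : ∀ {n} (j : Fin n) → inject₁ (inject₁ j) ≢ suc (suc j)
  skip zero    ()
  skip (suc j) = skip j ∘ suc-injective

module _ (T : Graph N) {p : Fin N} (p∈T : p ∈ V T) where
  private
    module T = Graph T

    _~_ : Fin (suc N) → Fin (suc N) → Set
    zero  ~ zero  = False
    zero  ~ suc t = t ≡ p
    suc s ~ zero  = s ≡ p
    suc s ~ suc t = T ⊢ s ~ t

    _~?_ : ∀ s t → Dec (s ~ t)
    zero  ~? zero  = no λ ()
    zero  ~? suc t = t ≟ᶠ p
    suc s ~? zero  = s ≟ᶠ p
    suc s ~? suc t = s T.~? t

    ~-sym : ∀ s t → s ~ t → t ~ s
    ~-sym zero    (suc t) e = e
    ~-sym (suc s) zero    e = e
    ~-sym (suc s) (suc t) e = T.~-sym e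

    ~-irrefl : ∀ s → ¬ s ~ s
    ~-irrefl (suc s) = T.~-irrefl

    ~⇒∈V : ∀ s t → s ~ t → s ∈ inside ∷ V T
    ~⇒∈V zero    _       _    = here
    ~⇒∈V (suc s) zero    refl = there p∈T
    ~⇒∈V (suc s) (suc t) e    = there (T.~⇒∈V e)

  addLeaf : Graph (suc N)
  addLeaf = record
    { V = inside ∷ V T ; _~_ = _~_ ; _~?_ = _~?_ ; ~-sym = λ {s} {t} → ~-sym s t
    ; ~-irrefl = λ {s} → ~-irrefl s ; ~⇒∈V = λ {s} {t} → ~⇒∈V s t }

  addLeaf-isTree : IsTree T → IsTree addLeaf
  addLeaf-isTree ((_ , linked) , acyclic) = ((zero , here) , linked′) , acyclic′
    where
    lift : ∀ {s t} → Linked T s t → Linked addLeaf (suc s) (suc t)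
    lift = Star.gmap suc λ e → e

    linked′ : ∀ {s t} → s ∈ inside ∷ V T → t ∈ inside ∷ V T → Linked addLeaf s t
    linked′ here       here       = ε
    linked′ here       (there t∈) = _◅_ {j = suc p} refl (lift (linked p∈T t∈))
    linked′ (there s∈) here       = lift (linked s∈ p∈T) ◅◅ (_◅_ {j = zero} refl ε)
    linked′ (there s∈) (there t∈) = lift (linked s∈ t∈)

    leaf-neighbour : ∀ {s t u} → s ≡ zero → s ~ t → s ~ u → t ≡ u
    leaf-neighbour {t = suc t} {suc u} refl refl refl = refl

    lower : (s : Fin (suc N)) → s ≢ zero → ∃[ t ] s ≡ suc t
    lower zero    s≢0 = contradiction refl s≢0
    lower (suc t) _   = t , refl

    lower-edge : ∀ {s t a b} → s ≡ suc a → t ≡ suc b → s ~ t → T ⊢ a ~ b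
    lower-edge refl refl e = e

    acyclic′ : ¬ Cycle addLeaf
    acyclic′ cyc@(k , c , c-injective , step , close) with any? (λ i → c i ≟ᶠ zero)
    ... | yes (i , ci≡0) =
      -- A leaf has a single neighbour, whereas a vertex of a cycle has neighbours at two different
      -- positions.
      let _ , _ , j≢l , ej , el = cycle-neighbours addLeaf cyc i
      in j≢l (c-injective (leaf-neighbour ci≡0 ej el))
    -- A cycle that misses the leaf is the image under `suc` of a cycle of `T`.
    ... | no  avoids = acyclic (k , proj₁ ∘ below
      , (λ {i} {j} eq → c-injective (trans (proj₂ (below i)) (trans (cong suc eq) (sym (proj₂ (below j))))))
      , (λ i → lower-edge (proj₂ (below (inject₁ i))) (proj₂ (below (suc i))) (step i))
      , lower-edge (proj₂ (below (fromℕ _))) (proj₂ (below zero)) close)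
      where
      below : ∀ i → ∃[ t ] c i ≡ suc t
      below i = lower (c i) λ ci≡0 → avoids (i , ci≡0)

attachBag : (Fin N → Subset n) → Subset n → Fin (suc N) → Subset n
attachBag bag B zero    = B
attachBag bag B (suc t) = bag t

module _ {G : Graph n} {U B : Subset n} (𝒯 : TreeDecomposition (G [ U ])) where
  private
    open module 𝒯 = TreeDecomposition 𝒯 using (T; bag)

  -- The first condition on `B` keeps the nodes of an old vertex of `B` connected, through `p`. The
  -- second puts every edge with an end outside `U` into the new bag.
  attach : ∀ {p} → p ∈ V T → B ⊆ V G → (∀ {u} → u ∈ B → u ∈ U → u ∈ bag p) →
    (∀ {u v} → u ∈ B → u ∉ U → v ∈ U → G ⊢ u ~ v → v ∈ B) → TreeDecomposition (G [ U ∪ B ])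
  attach {p} p∈T B⊆G B∩U⊆p closed = record
    { T         = T′
    ; isTree    = addLeaf-isTree T p∈T 𝒯.isTree
    ; bag       = bag′
    ; bag⊆V     = λ
      { {zero}  _          u∈ → x∈p∩q⁺ (B⊆G u∈ , x∈p∪q⁺ (inj₂ u∈))
      ; {suc t} (there t∈) u∈ → let u∈G , u∈U = x∈p∩q⁻ _ _ (𝒯.bag⊆V t∈ u∈) in x∈p∩q⁺ (u∈G , x∈p∪q⁺ (inj₁ u∈U)) }
    ; vertices  = vertices
    ; edges     = edges
    ; connected = λ u∈ → (let t , t∈T , u∈t = vertices u∈ in t , x∈p∩q⁺ (t∈T , ∈-nodes⁺ bag′ u∈t)) ,
        λ t∈ s∈ → let t∈T , t∈u = x∈p∩q⁻ _ _ t∈ ; s∈T , s∈u = x∈p∩q⁻ _ _ s∈ in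
          linked (proj₁ (x∈p∩q⁻ _ _ u∈)) t∈T s∈T (∈-nodes⁻ bag′ t∈u) (∈-nodes⁻ bag′ s∈u)
    }
    where
    T′ : Graph (suc 𝒯.N)
    T′ = addLeaf T p∈T

    bag′ : Fin (suc 𝒯.N) → Subset n
    bag′ = attachBag bag B

    vertices : ∀ {u} → u ∈ V G ∩ (U ∪ B) → ∃[ t ] (t ∈ V T′ × u ∈ bag′ t)
    vertices u∈ with u∈G , u∈U∪B ← x∈p∩q⁻ _ _ u∈ with x∈p∪q⁻ U B u∈U∪B
    ... | inj₁ u∈U = let t , t∈T , u∈t = 𝒯.vertices (x∈p∩q⁺ (u∈G , u∈U)) in suc t , there t∈T , u∈t
    ... | inj₂ u∈B = zero , here , u∈B

    meet : ∀ {u v} → u ∈ B → u ∉ U → G ⊢ u ~ v → v ∈ U ∪ B → v ∈ B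
    meet u∈B u∉U e v∈ with x∈p∪q⁻ U B v∈
    ... | inj₁ v∈U = closed u∈B u∉U v∈U e
    ... | inj₂ v∈B = v∈B

    new : ∀ {u} → u ∈ U ∪ B → u ∉ U → u ∈ B
    new u∈ u∉U with x∈p∪q⁻ U B u∈
    ... | inj₁ u∈U = contradiction u∈U u∉U
    ... | inj₂ u∈B = u∈B

    edges : ∀ {u v} → (G [ U ∪ B ]) ⊢ u ~ v → ∃[ t ] (t ∈ V T′ × u ∈ bag′ t × v ∈ bag′ t)
    edges {u} {v} (e , u∈ , v∈) with u ∈? U | v ∈? U
    ... | yes u∈U | yes v∈U = let t , t∈T , u∈t , v∈t = 𝒯.edges (e , u∈U , v∈U) in suc t , there t∈T , u∈t , v∈t
    ... | no  u∉U | _       = zero , here , new u∈ u∉U , meet (new u∈ u∉U) u∉U e v∈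
    ... | yes _   | no v∉U  = zero , here , meet (new v∈ v∉U) v∉U (Graph.~-sym G e) u∈ , new v∈ v∉U

    module _ {u} (u∈G : u ∈ V G) where
      old : ∀ {t s} → t ∈ V T → s ∈ V T → u ∈ bag t → u ∈ bag s → Linked (T′ [ nodes bag′ u ]) (suc t) (suc s)
      old {t} {s} t∈T s∈T u∈t u∈s = Star.gmap suc
        (λ (e , a∈ , b∈) → e , ∈-nodes⁺ bag′ (∈-nodes⁻ bag a∈) , ∈-nodes⁺ bag′ (∈-nodes⁻ bag b∈))
        (proj₂ (𝒯.connected (𝒯.bag⊆V t∈T u∈t)) (x∈p∩q⁺ (t∈T , ∈-nodes⁺ bag u∈t)) (x∈p∩q⁺ (s∈T , ∈-nodes⁺ bag u∈s)))

      covered : ∀ {t} → t ∈ V T → u ∈ bag t → u ∈ U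
      covered t∈T u∈t = proj₂ (x∈p∩q⁻ _ _ (𝒯.bag⊆V t∈T u∈t))

      linked : ∀ {t s} → t ∈ V T′ → s ∈ V T′ → u ∈ bag′ t → u ∈ bag′ s → Linked (T′ [ nodes bag′ u ]) t s
      linked here here _ _ = ε
      linked (there t∈T) (there s∈T) u∈t u∈s = old t∈T s∈T u∈t u∈s
      linked here (there s∈T) u∈B u∈s =
        let u∈p = B∩U⊆p u∈B (covered s∈T u∈s)
        in _◅_ {j = suc p} (refl , ∈-nodes⁺ bag′ u∈B , ∈-nodes⁺ bag′ u∈p) (old p∈T s∈T u∈p u∈s)
      linked (there t∈T) here u∈t u∈B =
        let u∈p = B∩U⊆p u∈B (covered t∈T u∈t)
        in old t∈T p∈T u∈t u∈p ◅◅ (_◅_ {j = zero} (refl , ∈-nodes⁺ bag′ u∈p , ∈-nodes⁺ bag′ u∈B) ε)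

spanning : {G : Graph n} {U : Subset n} → V G ⊆ U → TreeDecomposition (G [ U ]) → TreeDecomposition G
spanning {G = G} G⊆U 𝒯 = record
  { T         = T
  ; isTree    = isTree
  ; bag       = bag
  ; bag⊆V     = λ t∈T u∈t → proj₁ (x∈p∩q⁻ _ _ (bag⊆V t∈T u∈t))
  ; vertices  = λ u∈G → vertices (x∈p∩q⁺ (u∈G , G⊆U u∈G))
  ; edges     = λ e → edges (e , G⊆U (Graph.~⇒∈V G e) , G⊆U (Graph.~⇒∈V G (Graph.~-sym G e)))
  ; connected = λ u∈G → connected (x∈p∩q⁺ (u∈G , G⊆U u∈G))
  }
  where open TreeDecomposition 𝒯

-- Components, neighbourhoods and minimal separators.

_∖_ : Subset n → Subset n → Subset n
p ∖ q = p ∩ ∁ q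

infixl 6 _∖_

∈-∖⁺ : {p q : Subset n} {x : Fin n} → x ∈ p → x ∉ q → x ∈ p ∖ q
∈-∖⁺ x∈p x∉q = x∈p∩q⁺ (x∈p , x∉p⇒x∈∁p x∉q)

∈-∖⁻ : {p q : Subset n} {x : Fin n} → x ∈ p ∖ q → x ∈ p × x ∉ q
∈-∖⁻ {p = p} {q} x∈ = let x∈p , x∈∁q = x∈p∩q⁻ p (∁ q) x∈ in x∈p , x∈∁p⇒x∉p x∈∁q

∉-∖⇒∈ : {p q : Subset n} {x : Fin n} → x ∈ p → x ∉ p ∖ q → x ∈ q
∉-∖⇒∈ {q = q} {x} x∈p x∉ = decidable-stable (x ∈? q) λ x∉q → x∉ (∈-∖⁺ x∈p x∉q)

module _ (G : Graph n) where
  open Graph G hiding (V)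

  private variable
    X D C U : Subset n
    u v w x y z : Fin n

  ~⇒∈Vʳ : u ~ v → v ∈ V G
  ~⇒∈Vʳ = ~⇒∈V ∘ ~-sym

  linked-sym : Linked (G [ X ]) u v → Linked (G [ X ]) v u
  linked-sym {X = X} = Star.reverse (Graph.~-sym (G [ X ]))

  linked-mono : D ⊆ X → Linked (G [ D ]) u v → Linked (G [ X ]) u v
  linked-mono D⊆X = Star.map λ (e , u∈ , v∈) → e , D⊆X u∈ , D⊆X v∈

  -- Induction along a walk, with `K` as the invariant; most reachability arguments below are
  -- instances.
  propagate : (K : Fin n → Set) → (∀ {a b} → K a → b ∈ X → a ~ b → K b) →
    Linked (G [ X ]) u v → K u → K v
  propagate K step ε                 Ku = Ku
  propagate K step ((e , _ , b∈) ◅ path) Ku = propagate K step path (step Ku b∈ e)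

  -- Unlike `Connected`, this admits the empty set, which serves as `back` for components without
  -- neighbours.
  ConnectedSet : Subset n → Set
  ConnectedSet D = ∀ {u v} → u ∈ D → v ∈ D → Linked (G [ D ]) u v

  -- A walk inside `D` that starts in `C` can never leave `C`.
  sweep : ConnectedSet D → (∀ {a b} → a ∈ C → b ∈ D → a ~ b → b ∈ C) → u ∈ D → u ∈ C → D ⊆ C
  sweep {C = C} connected step u∈D u∈C v∈D = propagate (_∈ C) step (connected u∈D v∈D) u∈C

  Neighbour : Subset n → Fin n → Set
  Neighbour D w = w ∉ D × ∃[ u ] (u ∈ D × u ~ w)

  neighbour? : ∀ D w → Dec (Neighbour D w)
  neighbour? D w = ¬? (w ∈? D) ×-dec any? λ u → (u ∈? D) ×-dec (u ~? w)

  nbhd : Subset n → Subset n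
  nbhd D = comprehension (neighbour? D)

  ∈-nbhd⁺ : w ∉ D → u ∈ D → u ~ w → w ∈ nbhd D
  ∈-nbhd⁺ {D = D} w∉D u∈D e = ∈-comprehension⁺ (neighbour? D) (w∉D , _ , u∈D , e)

  ∈-nbhd⁻ : w ∈ nbhd D → Neighbour D w
  ∈-nbhd⁻ {D = D} = ∈-comprehension⁻ (neighbour? D)

  nbhd⊆V : nbhd D ⊆ V G
  nbhd⊆V w∈ = let _ , _ , _ , e = ∈-nbhd⁻ w∈ in ~⇒∈Vʳ e

  reach : ConnectedSet D → D ⊆ X → u ∈ D → w ∈ nbhd D → w ∈ X → Linked (G [ X ]) u w
  reach connected D⊆X u∈D w∈N w∈X =
    let _ , v , v∈D , e = ∈-nbhd⁻ w∈N
    in linked-mono D⊆X (connected u∈D v∈D) ◅◅ ((e , D⊆X v∈D , w∈X) ◅ ε)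

  through : ConnectedSet D → D ⊆ X → u ∈ nbhd D → u ∈ X → w ∈ nbhd D → w ∈ X → Linked (G [ X ]) u w
  through connected D⊆X u∈N u∈X w∈N w∈X =
    let _ , v , v∈D , _ = ∈-nbhd⁻ u∈N
    in linked-sym (reach connected D⊆X v∈D u∈N u∈X) ◅◅ reach connected D⊆X v∈D w∈N w∈X

  record Component (X D : Subset n) : Set where
    field
      within    : D ⊆ X
      nonempty  : Nonempty D
      connected : ConnectedSet D
      closed    : u ∈ D → w ∈ X → u ~ w → w ∈ D

    nbhd-outside : w ∈ nbhd D → w ∉ X
    nbhd-outside w∈N w∈X = let w∉D , _ , u∈D , e = ∈-nbhd⁻ w∈N in w∉D (closed u∈D w∈X e)

    neighbour : u ∈ D → w ∉ X → u ~ w → w ∈ nbhd D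
    neighbour u∈D w∉X e = ∈-nbhd⁺ (w∉X ∘ within) u∈D e

  open Component

  -- A connected set around `v` absorbs one adjacent vertex of `X` at a time until no edge leaves it
  -- within `X`.
  component : v ∈ X → ∃[ D ] (Component X D × v ∈ D)
  component {v} {X} v∈X = grow ⁅ v ⁆ (⊃-wellFounded _) (x∈⁅x⁆ v)
    (λ u∈ → subst (_∈ X) (sym (x∈⁅y⁆⇒x≡y v u∈)) v∈X)
    (λ u∈ → subst (Linked (G [ ⁅ v ⁆ ]) v) (sym (x∈⁅y⁆⇒x≡y v u∈)) ε)
    where
    grow : ∀ K → Acc (λ p q → q ⊂ p) K → v ∈ K → K ⊆ X → (∀ {u} → u ∈ K → Linked (G [ K ]) v u) →
      ∃[ D ] (Component X D × v ∈ D)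
    grow K (acc rec) v∈K K⊆X linked
      with any? (λ a → any? λ b → (a ∈? K) ×-dec (b ∈? X) ×-dec ¬? (b ∈? K) ×-dec (a ~? b))
    ... | no  stuck = K , record
      { within    = K⊆X
      ; nonempty  = v , v∈K
      ; connected = λ u∈ w∈ → linked-sym (linked u∈) ◅◅ linked w∈
      ; closed    = λ {u} {w} u∈K w∈X e → decidable-stable (w ∈? K) λ w∉K →
          stuck (u , w , u∈K , w∈X , w∉K , e)
      } , v∈K
    ... | yes (a , b , a∈K , b∈X , b∉K , e) =
      grow (K ∪ ⁅ b ⁆) (rec (old , b , new , b∉K)) (old v∈K) K′⊆X linked′
      where
      old : K ⊆ K ∪ ⁅ b ⁆
      old = p⊆p∪q ⁅ b ⁆
      new : b ∈ K ∪ ⁅ b ⁆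
      new = x∈p∪q⁺ (inj₂ (x∈⁅x⁆ b))
      K′⊆X : K ∪ ⁅ b ⁆ ⊆ X
      K′⊆X u∈ with x∈p∪q⁻ K ⁅ b ⁆ u∈
      ... | inj₁ u∈K = K⊆X u∈K
      ... | inj₂ u∈b = subst (_∈ X) (sym (x∈⁅y⁆⇒x≡y b u∈b)) b∈X
      linked′ : ∀ {u} → u ∈ K ∪ ⁅ b ⁆ → Linked (G [ K ∪ ⁅ b ⁆ ]) v u
      linked′ u∈ with x∈p∪q⁻ K ⁅ b ⁆ u∈
      ... | inj₁ u∈K = linked-mono old (linked u∈K)
      ... | inj₂ u∈b = subst (Linked (G [ K ∪ ⁅ b ⁆ ]) v) (sym (x∈⁅y⁆⇒x≡y b u∈b))
        (linked-mono old (linked a∈K) ◅◅ ((e , old a∈K , new) ◅ ε))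

  linked? : ∀ X u v → Dec (Linked (G [ X ]) u v)
  linked? X u v with u ≟ᶠ v | u ∈? X
  ... | yes refl | _       = yes ε
  -- Only the empty walk starts at a vertex outside `X`.
  ... | no  u≢v  | no  u∉X = no λ { ε → u≢v refl ; ((_ , u∈X , _) ◅ _) → u∉X u∈X }
  ... | no  _    | yes u∈X with D , isC , u∈D ← component u∈X =
    map′ (λ v∈D → linked-mono (within isC) (connected isC u∈D v∈D))
         (λ path → propagate (_∈ D) (closed isC) path u∈D)
         (v ∈? D)

  separator? : ∀ u v S → Dec (Separator G u v S)
  separator? u v S = (S ⊆? V G) ×-dec ¬? (u ∈? S) ×-dec ¬? (v ∈? S) ×-dec ¬? (linked? (∁ S) u v)

  minimal-separator : ∀ {S} → Separator G u v S → ∃[ T ] (T ⊆ S × MinimalSeparatorOf G u v T)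
  minimal-separator {u} {v} {S} = shrink (⊂-wellFounded S)
    where
    shrink : ∀ {S} → Acc _⊂_ S → Separator G u v S → ∃[ T ] (T ⊆ S × MinimalSeparatorOf G u v T)
    shrink {S} (acc rec) sep with anySubset? (λ T → (T ⊂? S) ×-dec separator? u v T)
    ... | yes (R , R⊂S , sepR) = let T , T⊆R , min = shrink (rec R⊂S) sepR in T , proj₁ R⊂S ∘ T⊆R , min
    ... | no  none = S , (λ t∈ → t∈) , sep , λ T⊂S sepT → none (_ , T⊂S , sepT)

  MinimalSeparatorOf-sym : ∀ {T} → MinimalSeparatorOf G u v T → MinimalSeparatorOf G v u T
  MinimalSeparatorOf-sym (sep , min) = separator-sym sep , λ T⊂ → min T⊂ ∘ separator-sym
    where
    separator-sym : ∀ {u v S} → Separator G u v S → Separator G v u S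
    separator-sym (S⊆V , u∉S , v∉S , apart) = S⊆V , v∉S , u∉S , apart ∘ linked-sym

  -- If `t` had no neighbour in `D`, a walk from `u` avoiding `T ∖ ⁅ t ⁆` could not leave `D`. Then
  -- the smaller set would still separate `u` from `v`, against minimality.
  minimalSeparator-full : ∀ {T} → MinimalSeparatorOf G u v T → Component (V G ∖ T) D → u ∈ D → T ⊆ nbhd D
  minimalSeparator-full {u} {v} {D} {T} ((T⊆V , u∉T , v∉T , apart) , minimal) isC u∈D {t} t∈T =
    decidable-stable (t ∈? nbhd D) λ t∉N → minimal T-t⊂T
      ( T⊆V ∘ proj₁ ∘ ∈-∖⁻ , u∉T ∘ proj₁ ∘ ∈-∖⁻ , v∉T ∘ proj₁ ∘ ∈-∖⁻
      , λ path → apart (linked-mono D⊆∁T (connected isC u∈D (propagate (_∈ D) (step t∉N) path u∈D))) )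
    where
    D⊆∁T : D ⊆ ∁ T
    D⊆∁T w∈D = x∉p⇒x∈∁p (proj₂ (∈-∖⁻ (within isC w∈D)))
    T-t⊂T : T ∖ ⁅ t ⁆ ⊂ T
    T-t⊂T = proj₁ ∘ ∈-∖⁻ , t , t∈T , λ t∈ → proj₂ (∈-∖⁻ {p = T} t∈) (x∈⁅x⁆ t)
    step : t ∉ nbhd D → ∀ {a b} → a ∈ D → b ∈ ∁ (T ∖ ⁅ t ⁆) → a ~ b → b ∈ D
    step t∉N {a} {b} a∈D b∈ e with b ∈? T
    ... | no  b∉T = closed isC a∈D (∈-∖⁺ (~⇒∈Vʳ e) b∉T) e
    ... | yes b∈T with refl ← x∈⁅y⁆⇒x≡y t (∉-∖⇒∈ b∈T (x∈∁p⇒x∉p b∈)) =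
      contradiction (neighbour isC a∈D (λ t∈ → proj₂ (∈-∖⁻ {p = V G} t∈) t∈T) e) t∉N

  -- Backed sets, whose neighbourhoods are minimal separators.

  record Backed (D : Subset n) : Set where
    field
      back         : Subset n
      back⊆V       : back ⊆ V G
      connected    : ConnectedSet back
      disjoint     : u ∈ back → u ∉ D
      anticomplete : u ∈ back → v ∈ D → ¬ v ~ u
      -- With `back` empty this forces `nbhd D` to be empty, as for a component of `G` itself.
      full         : nbhd D ⊆ nbhd back

    back∉nbhd : u ∈ back → u ∉ nbhd D
    back∉nbhd u∈ u∈N = let _ , _ , v∈D , e = ∈-nbhd⁻ u∈N in anticomplete u∈ v∈D e

  -- A walk that avoids `nbhd D` stays in `D`, so `d` and `a` are separated. Once some `w` of
  -- `nbhd D` is released, `d` reaches `w` through `D`, and `w` reaches `a` through `back` by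
  -- `full`.
  nbhd-minimalSeparator : D ⊆ V G → ConnectedSet D → Nonempty D → (b : Backed D) → Nonempty (Backed.back b) →
    MinimalSeparator G (nbhd D)
  nbhd-minimalSeparator {D} D⊆V conn (d , d∈D) b (a , a∈A) =
    d , a , D⊆V d∈D , back⊆V a∈A , (λ { refl → disjoint a∈A d∈D }) , anticomplete a∈A d∈D ,
    (nbhd⊆V , (λ d∈N → proj₁ (∈-nbhd⁻ d∈N) d∈D) , back∉nbhd a∈A ,
      λ path → disjoint a∈A (propagate (_∈ D) step path d∈D)) ,
    minimal
    where
    open Backed b hiding (connected)
    step : ∀ {a b} → a ∈ D → b ∈ ∁ (nbhd D) → a ~ b → b ∈ D
    step {b = b} a∈D b∈ e = decidable-stable (b ∈? D) λ b∉D → x∈∁p⇒x∉p b∈ (∈-nbhd⁺ b∉D a∈D e)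
    minimal : ∀ {S} → S ⊂ nbhd D → ¬ Separator G d a S
    minimal {S} (S⊆N , w , w∈N , w∉S) (_ , _ , _ , apart) = apart
      (reach conn (λ u∈D → x∉p⇒x∈∁p λ u∈S → proj₁ (∈-nbhd⁻ (S⊆N u∈S)) u∈D) d∈D w∈N (x∉p⇒x∈∁p w∉S)
       ◅◅ linked-sym (reach (Backed.connected b) (λ u∈A → x∉p⇒x∈∁p (back∉nbhd u∈A ∘ S⊆N)) a∈A (full w∈N) (x∉p⇒x∈∁p w∉S)))

  Empty⇒∣∣≤ : Empty X → ∣ X ∣ ≤ k
  Empty⇒∣∣≤ empty = ℕ.≤-trans (ℕ.≤-reflexive (trans (cong ∣_∣ (Empty-unique empty)) (∣⊥∣≡0 n))) z≤n

  -- Pairs of vertices attached to a common component.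

  Shared : Subset n → Fin n → Fin n → Set
  Shared Ω x y = ∃[ D ] (Component (V G ∖ Ω) D × x ∈ nbhd D × y ∈ nbhd D)

  linked⇒shared : ∀ {Ω} → x ∈ Ω → y ∈ Ω → x ≢ y → ¬ x ~ y →
    Linked (G -ᴳ (Ω ∖ (⁅ x ⁆ ∪ ⁅ y ⁆))) x y → Shared Ω x y
  linked⇒shared {x} {y} {Ω} x∈Ω y∈Ω x≢y x≁y path with propagate Reached step path (inj₂ (inj₁ refl))
    where
    Reached : Fin n → Set
    -- Since its last visit to `x` the walk has stayed in one component attached to `x`. When it
    -- steps from there to `y`, that component is attached to both ends.
    Reached w = Shared Ω x y ⊎ w ≡ x ⊎ ∃[ D ] (Component (V G ∖ Ω) D × x ∈ nbhd D × w ∈ D)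

    ∉outside : ∀ {w} → w ∈ Ω → w ∉ V G ∖ Ω
    ∉outside w∈Ω w∈ = proj₂ (∈-∖⁻ {p = V G} w∈) w∈Ω

    step : ∀ {a b} → Reached a → b ∈ ∁ (Ω ∖ (⁅ x ⁆ ∪ ⁅ y ⁆)) → a ~ b → Reached b
    step (inj₁ shared) _ _ = inj₁ shared
    step {a} {b} (inj₂ r) b∈ e with b ∈? Ω
    step {a} {b} (inj₂ r) b∈ e | yes b∈Ω with x∈p∪q⁻ ⁅ x ⁆ ⁅ y ⁆ (∉-∖⇒∈ b∈Ω (x∈∁p⇒x∉p b∈))
    ... | inj₁ b∈x = inj₂ (inj₁ (x∈⁅y⁆⇒x≡y x b∈x))
    ... | inj₂ b∈y with refl ← x∈⁅y⁆⇒x≡y y b∈y | r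
    ...   | inj₁ refl = contradiction e x≁y
    ...   | inj₂ (D , isC , x∈N , a∈D) = inj₁ (D , isC , x∈N , neighbour isC a∈D (∉outside y∈Ω) e)
    step {a} {b} (inj₂ (inj₁ refl)) b∈ e | no b∉Ω with D , isC , b∈D ← component (∈-∖⁺ (~⇒∈Vʳ e) b∉Ω) =
      inj₂ (inj₂ (D , isC , neighbour isC b∈D (∉outside x∈Ω) (~-sym e) , b∈D))
    step {a} {b} (inj₂ (inj₂ (D , isC , x∈N , a∈D))) b∈ e | no b∉Ω =
      inj₂ (inj₂ (D , isC , x∈N , closed isC a∈D (∈-∖⁺ (~⇒∈Vʳ e) b∉Ω) e))
  ... | inj₁ shared = shared
  ... | inj₂ (inj₁ y≡x) = contradiction (sym y≡x) x≢y
  ... | inj₂ (inj₂ (D , isC , _ , y∈D)) = contradiction y∈Ω (proj₂ (∈-∖⁻ {p = V G} (within isC y∈D)))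

  -- Together with the absence of a component of `G - Ω` attached to all of `Ω`, this characterises
  -- potential maximal cliques, the maximal cliques of minimal triangulations.
  Cliquish : Subset n → Set
  Cliquish Ω = ∀ {x y} → x ∈ Ω → y ∈ Ω → x ≢ y → ¬ x ~ y → Shared Ω x y

  -- The set of all other vertices separates `x` from `y` and contains a minimal separator.
  separate : x ≢ y → ¬ x ~ y → ∃[ T ] MinimalSeparatorOf G x y T
  separate {x} {y} x≢y x≁y =
    let T , _ , min = minimal-separator {x} {y} {V G ∖ (⁅ x ⁆ ∪ ⁅ y ⁆)}
          ( proj₁ ∘ ∈-∖⁻
          , (λ x∈ → proj₂ (∈-∖⁻ {p = V G} x∈) (x∈p∪q⁺ (inj₁ (x∈⁅x⁆ x))))
          , (λ y∈ → proj₂ (∈-∖⁻ {p = V G} y∈) (x∈p∪q⁺ (inj₂ (x∈⁅x⁆ y))))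
          , λ path → x≢y (sym (propagate (_≡ x) stay path refl)) )
    in T , min
    where
    stay : ∀ {a b} → a ≡ x → b ∈ ∁ (V G ∖ (⁅ x ⁆ ∪ ⁅ y ⁆)) → a ~ b → b ≡ x
    stay refl b∈ e with x∈p∪q⁻ ⁅ x ⁆ ⁅ y ⁆ (∉-∖⇒∈ (~⇒∈Vʳ e) (x∈∁p⇒x∉p b∈))
    ... | inj₁ b∈x = x∈⁅y⁆⇒x≡y x b∈x
    ... | inj₂ b∈y with refl ← x∈⁅y⁆⇒x≡y y b∈y = contradiction e x≁y

  -- Refining the closed neighbourhood of a backed component to a cliquish set.

  module _ {C : Subset n} (C⊆V : C ⊆ V G) (C-connected : ConnectedSet C) (C-nonempty : Nonempty C) (C-backed : Backed C) where
    private
      open module Back = Backed C-backed using () renaming (back to A)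

    record Good (Ω : Subset n) : Set where
      field
        nbhd⊆  : nbhd C ⊆ Ω
        local  : u ∈ Ω → u ∈ nbhd C ⊎ u ∈ C
        -- This makes the next bag contain a vertex that is not yet decomposed.
        meets  : ∃[ c ] (c ∈ C × c ∈ Ω)
        backed : Component (V G ∖ Ω) D → Backed D

      ⊆V : Ω ⊆ V G
      ⊆V u∈Ω with local u∈Ω
      ... | inj₁ u∈N = nbhd⊆V u∈N
      ... | inj₂ u∈C = C⊆V u∈C

      back∉ : u ∈ A → u ∉ Ω
      back∉ u∈A u∈Ω with local u∈Ω
      ... | inj₁ u∈N = Back.back∉nbhd u∈A u∈N
      ... | inj₂ u∈C = Back.disjoint u∈A u∈C

    -- A component outside is backed by `C`: it has no edge to `C`, so all its neighbours lie in
    -- `nbhd C`.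
    closed-nbhd-good : Good (nbhd C ∪ C)
    closed-nbhd-good = record
      { nbhd⊆  = x∈p∪q⁺ ∘ inj₁
      ; local  = x∈p∪q⁻ _ C
      ; meets  = let c , c∈C = C-nonempty in c , c∈C , x∈p∪q⁺ (inj₂ c∈C)
      ; backed = λ {D} isD → record
        { back         = C
        ; back⊆V       = C⊆V
        ; connected    = C-connected
        ; disjoint     = λ u∈C u∈D → beyond isD u∈D (inj₂ u∈C)
        ; anticomplete = λ u∈C v∈D e → beyond isD v∈D (near u∈C (~-sym e))
        ; full         = λ {w} w∈N →
            let _ , u , u∈D , e = ∈-nbhd⁻ w∈N
                w∈ = decidable-stable (w ∈? nbhd C ∪ C) λ w∉ → nbhd-outside isD w∈N (∈-∖⁺ (~⇒∈Vʳ e) w∉)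
            in [ id , (λ w∈C → contradiction (near w∈C (~-sym e)) (beyond isD u∈D)) ]′ (x∈p∪q⁻ _ C w∈)
        }
      }
      where
      beyond : Component (V G ∖ (nbhd C ∪ C)) D → u ∈ D → ¬ (u ∈ nbhd C ⊎ u ∈ C)
      beyond isD u∈D u∈ = proj₂ (∈-∖⁻ {p = V G} (within isD u∈D)) (x∈p∪q⁺ u∈)
      near : u ∈ C → u ~ v → v ∈ nbhd C ⊎ v ∈ C
      near {v = v} u∈C e with v ∈? C
      ... | yes v∈C = inj₂ v∈C
      ... | no  v∉C = inj₁ (∈-nbhd⁺ v∉C u∈C e)

    module _ {Ω : Subset n} (good : Good Ω) where
      private module Ω = Good good

      -- Removing `Y` creates one new component of the complement, namely `Y` itself: its neighbours
      -- lie in `T`, which stays in the bag. It is backed by `X`, because `X` is attached to all of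
      -- `T`.
      good-remove : ∀ {T X Y} → x ∈ Ω → y ∈ Ω → T ⊆ Ω → MinimalSeparatorOf G x y T →
        Component (V G ∖ T) X → x ∈ X → Component (V G ∖ T) Y → y ∈ Y →
        (∀ {u} → u ∈ X → u ∉ Y) → Empty (A ∩ Y) → Good (Ω ∖ Y)
      good-remove {x} {y} {T} {X} {Y} x∈Ω y∈Ω T⊆Ω min isX x∈X isY y∈Y X∩Y A∩Y = record
        { nbhd⊆  = λ s∈N → ∈-∖⁺ (Ω.nbhd⊆ s∈N) (nbhd∉Y s∈N)
        ; local  = Ω.local ∘ proj₁ ∘ ∈-∖⁻
        ; meets  = meets
        ; backed = backed
        }
        where
        -- A vertex of `nbhd C` has a neighbour in `A`, which avoids `T`; if the vertex were in `Y`,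
        -- so would be this neighbour.
        nbhd∉Y : ∀ {s} → s ∈ nbhd C → s ∉ Y
        nbhd∉Y s∈N s∈Y =
          let _ , a , a∈A , e = ∈-nbhd⁻ (Back.full s∈N)
          in A∩Y (a , x∈p∩q⁺ (a∈A , closed isY s∈Y (∈-∖⁺ (Back.back⊆V a∈A) (Ω.back∉ a∈A ∘ T⊆Ω)) (~-sym e)))

        y∈C : y ∈ C
        y∈C with Ω.local y∈Ω
        ... | inj₁ y∈N = contradiction y∈Y (nbhd∉Y y∈N)
        ... | inj₂ y∈C = y∈C

        nbhdY⊆T : nbhd Y ⊆ T
        nbhdY⊆T {w} w∈N = decidable-stable (w ∈? T) λ w∉T → nbhd-outside isY w∈N (∈-∖⁺ (nbhd⊆V w∈N) w∉T)

        exit : ∀ {a b} → a ∈ Y → a ~ b → b ∈ Y ⊎ b ∈ Ω ∖ Y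
        exit {b = b} a∈Y e with b ∈? Y
        ... | yes b∈Y = inj₁ b∈Y
        ... | no  b∉Y = inj₂ (∈-∖⁺ (T⊆Ω (nbhdY⊆T (∈-nbhd⁺ b∉Y a∈Y e))) b∉Y)

        meets : ∃[ c ] (c ∈ C × c ∈ Ω ∖ Y)
        meets with any? (λ c → (c ∈? C) ×-dec (c ∈? Ω ∖ Y))
        ... | yes found = found
        -- If `Ω ∖ Y` missed `C`, then `C` could not leave `Y`. As `x` lies in `C` or next to it,
        -- `x` would lie in `Y` too.
        ... | no  none  = contradiction x∈Y (X∩Y x∈X)
          where
          C⊆Y : C ⊆ Y
          C⊆Y = sweep C-connected stay y∈C y∈Y
            where
            stay : ∀ {a b} → a ∈ Y → b ∈ C → a ~ b → b ∈ Y
            stay a∈Y b∈C e with exit a∈Y e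
            ... | inj₁ b∈Y = b∈Y
            ... | inj₂ b∈Ω = contradiction (_ , b∈C , b∈Ω) none
          x∈Y : x ∈ Y
          x∈Y with Ω.local x∈Ω
          ... | inj₁ x∈N = let _ , c , c∈C , e = ∈-nbhd⁻ x∈N in closed isY (C⊆Y c∈C) (within isX x∈X) e
          ... | inj₂ x∈C = C⊆Y x∈C

        Y-backed : Backed Y
        Y-backed = record
          { back         = X
          ; back⊆V       = proj₁ ∘ ∈-∖⁻ ∘ within isX
          ; connected    = connected isX
          ; disjoint     = X∩Y
          ; anticomplete = λ u∈X v∈Y e → X∩Y u∈X (closed isY v∈Y (within isX u∈X) e)
          ; full         = minimalSeparator-full min isX x∈X ∘ nbhdY⊆T
          }

        ⊆Y : Component (V G ∖ (Ω ∖ Y)) D → u ∈ D → u ∈ Y → D ⊆ Y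
        ⊆Y {D} isD = sweep (connected isD) stay
          where
          stay : ∀ {a b} → a ∈ Y → b ∈ D → a ~ b → b ∈ Y
          stay a∈Y b∈D e with exit a∈Y e
          ... | inj₁ b∈Y = b∈Y
          ... | inj₂ b∈Ω = contradiction b∈Ω (proj₂ (∈-∖⁻ {p = V G} (within isD b∈D)))

        backed : Component (V G ∖ (Ω ∖ Y)) D → Backed D
        backed {D} isD with d , d∈D ← nonempty isD with d ∈? Y
        ... | yes d∈Y = subst Backed (⊆-antisym Y⊆D (⊆Y isD d∈D d∈Y)) Y-backed
          where
          Y⊆D : Y ⊆ D
          Y⊆D = sweep (connected isY) (λ a∈D b∈Y e → closed isD a∈D
            (∈-∖⁺ (~⇒∈Vʳ e) λ b∈ → proj₂ (∈-∖⁻ {p = Ω} b∈) b∈Y) e) d∈Y d∈D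
        -- A component that misses `Y` avoids all of `Ω`, so it was a component of `G - Ω` before.
        ... | no  d∉Y = Ω.backed record
          { within    = λ {w} w∈D → let w∈V , w∉ = ∈-∖⁻ {p = V G} (within isD w∈D) in
              ∈-∖⁺ w∈V λ w∈Ω → d∉Y (⊆Y isD w∈D (∉-∖⇒∈ w∈Ω w∉) d∈D)
          ; nonempty  = nonempty isD
          ; connected = connected isD
          ; closed    = λ u∈D w∈ e → let w∈V , w∉Ω = ∈-∖⁻ {p = V G} w∈ in
              closed isD u∈D (∈-∖⁺ w∈V (w∉Ω ∘ proj₁ ∘ ∈-∖⁻)) e
          }

      -- The set `A` is connected and avoids `Ω`, hence `T`, so it cannot meet both `X` and `Y`. A
      -- side that it misses is removed.
      good-shrink : x ∈ Ω → y ∈ Ω → Separator G x y (Ω ∖ (⁅ x ⁆ ∪ ⁅ y ⁆)) →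
        ∃[ Ω′ ] (Good Ω′ × Ω′ ⊂ Ω)
      good-shrink {x} {y} x∈Ω y∈Ω sep
        with T , T⊆ , min@((T⊆V , x∉T , y∉T , apart) , _) ← minimal-separator sep
        with X , isX , x∈X ← component (∈-∖⁺ (Ω.⊆V x∈Ω) x∉T)
           | Y , isY , y∈Y ← component (∈-∖⁺ (Ω.⊆V y∈Ω) y∉T)
        = side (nonempty? (A ∩ Y))
        where
        T⊆Ω : T ⊆ Ω
        T⊆Ω = proj₁ ∘ ∈-∖⁻ ∘ T⊆

        avoid : ∀ {D} → Component (V G ∖ T) D → D ⊆ ∁ T
        avoid isD u∈D = x∉p⇒x∈∁p (proj₂ (∈-∖⁻ (within isD u∈D)))

        X∩Y : ∀ {u} → u ∈ X → u ∉ Y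
        X∩Y u∈X u∈Y = apart (linked-mono (avoid isX) (connected isX x∈X u∈X)
          ◅◅ linked-mono (avoid isY) (connected isY u∈Y y∈Y))

        remove-⊂ : ∀ {z Z} → z ∈ Ω → z ∈ Z → Ω ∖ Z ⊂ Ω
        remove-⊂ {z} z∈Ω z∈Z = proj₁ ∘ ∈-∖⁻ , z , z∈Ω , λ z∈ → proj₂ (∈-∖⁻ {p = Ω} z∈) z∈Z

        side : Dec (Nonempty (A ∩ Y)) → ∃[ Ω′ ] (Good Ω′ × Ω′ ⊂ Ω)
        side (no  A∩Y) = Ω ∖ Y , good-remove x∈Ω y∈Ω T⊆Ω min isX x∈X isY y∈Y X∩Y A∩Y , remove-⊂ y∈Ω y∈Y
        side (yes (a , a∈)) = Ω ∖ X , good-remove y∈Ω x∈Ω T⊆Ω (MinimalSeparatorOf-sym min) isY y∈Y isX x∈X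
          (λ u∈Y u∈X → X∩Y u∈X u∈Y)
          (λ (b , b∈) → let b∈A , b∈X = x∈p∩q⁻ A X b∈ in X∩Y b∈X (A⊆Y b∈A)) , remove-⊂ x∈Ω x∈X
          where
          A⊆Y : A ⊆ Y
          A⊆Y = let a∈A , a∈Y = x∈p∩q⁻ A Y a∈ in sweep Back.connected
            (λ u∈Y w∈A e → closed isY u∈Y (∈-∖⁺ (Back.back⊆V w∈A) (Ω.back∉ w∈A ∘ T⊆Ω)) e) a∈A a∈Y

    good-cliquish : ∃[ Ω ] (Good Ω × Cliquish Ω)
    good-cliquish = refine (⊂-wellFounded _) closed-nbhd-good
      where
      refine : ∀ {Ω} → Acc _⊂_ Ω → Good Ω → ∃[ Ω′ ] (Good Ω′ × Cliquish Ω′)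
      refine {Ω} (acc rec) good
        -- Equal or adjacent pairs never pass this test, since they remain linked.
        with any? (λ x → any? λ y → (x ∈? Ω) ×-dec (y ∈? Ω) ×-dec separator? x y (Ω ∖ (⁅ x ⁆ ∪ ⁅ y ⁆)))
      ... | yes (x , y , x∈Ω , y∈Ω , sep) = let _ , good′ , Ω′⊂Ω = good-shrink good x∈Ω y∈Ω sep in
        refine (rec Ω′⊂Ω) good′
      ... | no  none = Ω , good , λ {x} {y} x∈Ω y∈Ω x≢y x≁y → linked⇒shared x∈Ω y∈Ω x≢y x≁y
        (decidable-stable (linked? _ x y) λ apart → none (x , y , x∈Ω , y∈Ω
          , Good.⊆V good ∘ proj₁ ∘ ∈-∖⁻
          , (λ x∈ → proj₂ (∈-∖⁻ {p = Ω} x∈) (x∈p∪q⁺ (inj₁ (x∈⁅x⁆ x))))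
          , (λ y∈ → proj₂ (∈-∖⁻ {p = Ω} y∈) (x∈p∪q⁺ (inj₂ (x∈⁅x⁆ y))))
          , apart))

  -- Independent sets inside cliquish sets.

  module _ (small : ∀ {S} → MinimalSeparator G S → ∣ S ∣ ≤ k) where

    -- A neighbour of `D` yields a vertex of `back`, the second end that a separator requires;
    -- without neighbours the bound is trivial.
    backed-small : D ⊆ V G → ConnectedSet D → Nonempty D → Backed D → ∣ nbhd D ∣ ≤ k
    backed-small {D} D⊆V conn d b with nonempty? (nbhd D)
    ... | no  empty = Empty⇒∣∣≤ empty
    ... | yes (w , w∈N) =
      let _ , a , a∈A , _ = ∈-nbhd⁻ (Backed.full b w∈N)
      in small (nbhd-minimalSeparator D⊆V conn d b (a , a∈A))

    cliquish-independence : ∀ {Ω} → Cliquish Ω → (∀ {D} → Component (V G ∖ Ω) D → ∣ nbhd D ∣ ≤ k) →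
      IndependenceBounded G ((k + 2) * suc k) Ω
    cliquish-independence {Ω} cliquish thin {I} (I⊆V , no-edge) I⊆Ω with nonempty? I
    ... | no  empty = Empty⇒∣∣≤ empty
    ... | yes (x , x∈I) with any? (λ y → (y ∈? I) ×-dec ¬? (x ≟ᶠ y))
    ...   | no  alone = ℕ.≤-trans (p⊆q⇒∣p∣≤∣q∣ {q = ⁅ x ⁆} λ {y} y∈I →
              subst (_∈ ⁅ x ⁆) (decidable-stable (x ≟ᶠ y) λ x≢y → alone (y , y∈I , x≢y)) (x∈⁅x⁆ x))
            (ℕ.≤-trans (ℕ.≤-reflexive (∣⁅x⁆∣≡1 x)) (ℕ.*-mono-≤ (ℕ.≤-trans (s≤s z≤n) (ℕ.m≤n+m 2 k)) (s≤s (z≤n {k}))))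
    -- The factor `k + 2` counts `T` together with `x` and `y`.
    ...   | yes (y , y∈I , x≢y) = ℕ.≤-trans (∣∣-cover {T = T ∪ (⁅ x ⁆ ∪ ⁅ y ⁆)} (λ {t} _ → F-small t) cover)
            (ℕ.*-monoˡ-≤ (suc k) (ℕ.≤-trans (∣p∪q∣≤∣p∣+∣q∣ T _) (ℕ.+-mono-≤
              (small (x , y , I⊆V x∈I , I⊆V y∈I , x≢y , no-edge x∈I y∈I , min))
              (ℕ.≤-trans (∣p∪q∣≤∣p∣+∣q∣ ⁅ x ⁆ ⁅ y ⁆) (ℕ.≤-reflexive (cong₂ _+_ (∣⁅x⁆∣≡1 x) (∣⁅x⁆∣≡1 y)))))))
      where
      T : Subset n
      T = proj₁ (separate x≢y (no-edge x∈I y∈I))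

      min : MinimalSeparatorOf G x y T
      min = proj₂ (separate x≢y (no-edge x∈I y∈I))

      -- The members of `I` charged to `t` lie here. The singleton serves `t` in `Ω`, and `suc k`
      -- bounds its size even when `k` is zero.
      F : Fin n → Subset n
      F t with t ∈? V G ∖ Ω
      ... | yes t∈ = nbhd (proj₁ (component t∈))
      ... | no  _  = ⁅ t ⁆

      F-small : ∀ t → ∣ F t ∣ ≤ suc k
      F-small t with t ∈? V G ∖ Ω
      ... | yes t∈ = ℕ.m≤n⇒m≤1+n (thin (proj₁ (proj₂ (component t∈))))
      ... | no  _  = ℕ.≤-trans (ℕ.≤-reflexive (∣⁅x⁆∣≡1 t)) (s≤s z≤n)

      self : ∀ {t} → t ∈ Ω → t ∈ F t
      self {t} t∈Ω with t ∈? V G ∖ Ω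
      ... | yes t∈ = contradiction t∈Ω (proj₂ (∈-∖⁻ {p = V G} t∈))
      ... | no  _  = x∈⁅x⁆ t

      ∈F : ∀ {t z D} → Component (V G ∖ Ω) D → t ∈ D → z ∈ nbhd D → z ∈ F t
      ∈F {t} {z} {D} isD t∈D z∈N with t ∈? V G ∖ Ω
      ... | no  t∉ = contradiction (within isD t∈D) t∉
      ... | yes t∈ with E , isE , t∈E ← component t∈ =
        let _ , u , u∈D , e = ∈-nbhd⁻ z∈N
            -- The component computed for `t` in `F` need not be `D` syntactically, but it contains
            -- `D` since both contain `t`.
            D⊆E = sweep (connected isD) (λ a∈E b∈D → closed isE a∈E (within isD b∈D)) t∈D t∈E
        in neighbour isE (D⊆E u∈D) (nbhd-outside isD z∈N) e

      cover : ∀ {z} → z ∈ I → ∃[ t ] (t ∈ T ∪ (⁅ x ⁆ ∪ ⁅ y ⁆) × z ∈ F t)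
      cover {z} z∈I with x ≟ᶠ z | z ≟ᶠ y | z ∈? T
      ... | yes refl | _        | _       = x , x∈p∪q⁺ (inj₂ (x∈p∪q⁺ (inj₁ (x∈⁅x⁆ x)))) , self (I⊆Ω z∈I)
      ... | no _     | yes refl | _       = y , x∈p∪q⁺ (inj₂ (x∈p∪q⁺ (inj₂ (x∈⁅x⁆ y)))) , self (I⊆Ω z∈I)
      ... | no _     | no _     | yes z∈T = z , x∈p∪q⁺ (inj₁ z∈T) , self (I⊆Ω z∈I)
      ... | no x≢z   | no z≢y   | no  z∉T
        with D , isD , x∈D , z∈D ← cliquish (I⊆Ω x∈I) (I⊆Ω z∈I) x≢z (no-edge x∈I z∈I)
           | E , isE , z∈E , y∈E ← cliquish (I⊆Ω z∈I) (I⊆Ω y∈I) z≢y (no-edge z∈I y∈I)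
        with nonempty? (T ∩ D) | nonempty? (T ∩ E)
      ... | yes (t , t∈) | _ = let t∈T , t∈D = x∈p∩q⁻ T D t∈ in t , x∈p∪q⁺ (inj₁ t∈T) , ∈F isD t∈D z∈D
      ... | no _ | yes (t , t∈) = let t∈T , t∈E = x∈p∩q⁻ T E t∈ in t , x∈p∪q⁺ (inj₁ t∈T) , ∈F isE t∈E z∈E
      -- The walk from `x` through `D` to `z` and on through `E` to `y` would avoid `T`.
      ... | no T∩D | no T∩E =
        let (_ , x∉T , y∉T , apart) , _ = min in contradiction
          (through (connected isD) (avoid T∩D) x∈D (x∉p⇒x∈∁p x∉T) z∈D (x∉p⇒x∈∁p z∉T)
           ◅◅ through (connected isE) (avoid T∩E) z∈E (x∉p⇒x∈∁p z∉T) y∈E (x∉p⇒x∈∁p y∉T)) apart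
        where
        avoid : ∀ {D} → Empty (T ∩ D) → D ⊆ ∁ T
        avoid empty u∈D = x∉p⇒x∈∁p λ u∈T → empty (_ , x∈p∩q⁺ (u∈T , u∈D))

    -- Building the decomposition bag by bag.

    private
      b : ℕ
      b = (k + 2) * suc k

    -- Here `U` is the part decomposed so far. The field `pending` provides, for each remaining
    -- component, a node at which its first bag can be attached.
    record Partial (U : Subset n) : Set₁ where
      field
        𝒯 : TreeDecomposition (G [ U ])
      open TreeDecomposition 𝒯 public using (T; bag)
      field
        bounded : ∀ {t} → t ∈ V T → IndependenceBounded G b (bag t)
        pending : Component (V G ∖ U) D → Backed D × ∃[ p ] (p ∈ V T × nbhd D ⊆ bag p)

    empty-partial : Partial ∅
    empty-partial = record
      -- A tree has at least one node, so the construction starts from a single empty bag.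
      { 𝒯       = oneBag (G [ ∅ ])
      ; bounded = λ _ _ I⊆ → Empty⇒∣∣≤ λ (_ , u∈I) → ∉⊥ (proj₂ (x∈p∩q⁻ (V G) ∅ (I⊆ u∈I)))
      ; pending = λ isD →
          let no-neighbours : ∀ {w} → w ∉ nbhd _
              no-neighbours w∈N = nbhd-outside isD w∈N (∈-∖⁺ (nbhd⊆V w∈N) ∉⊥)
          in record
            { back         = ∅
            ; back⊆V       = λ u∈ → contradiction u∈ ∉⊥
            ; connected    = λ u∈ → contradiction u∈ ∉⊥
            ; disjoint     = λ u∈ → contradiction u∈ ∉⊥
            ; anticomplete = λ u∈ → contradiction u∈ ∉⊥
            ; full         = λ w∈N → contradiction w∈N no-neighbours
            } , zero , here , λ w∈N → contradiction w∈N no-neighbours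
      }

    -- A good set for the component `C` of `v` meets `U` only in `nbhd C`, which lies in the bag at
    -- `p`. Its vertices outside `U` lie in `C`, so their neighbours in `U` belong to `nbhd C` and
    -- hence to the new bag.
    extend : Partial U → v ∈ V G ∖ U → ∃[ Ω ] (Partial (U ∪ Ω) × U ⊂ U ∪ Ω)
    extend {U} 𝒫 v∈ with C , isC , _ ← component v∈
      with C-backed , p , p∈T , N⊆p ← Partial.pending 𝒫 isC
      with Ω , good , cliquish ← good-cliquish (proj₁ ∘ ∈-∖⁻ ∘ within isC) (connected isC) (nonempty isC) C-backed
      = Ω , record
        { 𝒯       = attach {G = G} 𝒯 p∈T Ω.⊆V Ω∩U⊆p closed′
        ; bounded = λ
          { {zero}  _           → cliquish-independence cliquish λ isD → backed-small
              (proj₁ ∘ ∈-∖⁻ ∘ within isD) (connected isD) (nonempty isD) (Ω.backed isD)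
          ; {suc t} (there t∈T) → bounded t∈T }
        ; pending = pending′
        } , p⊆p∪q Ω , grows
      where
      open Partial 𝒫
      module Ω = Good good

      C∉U : u ∈ C → u ∉ U
      C∉U = proj₂ ∘ ∈-∖⁻ {p = V G} ∘ within isC

      N⊆U : nbhd C ⊆ U
      N⊆U w∈N = ∉-∖⇒∈ (nbhd⊆V w∈N) (nbhd-outside isC w∈N)

      Ω∩U⊆N : u ∈ Ω → u ∈ U → u ∈ nbhd C
      Ω∩U⊆N u∈Ω u∈U with Ω.local u∈Ω
      ... | inj₁ u∈N = u∈N
      ... | inj₂ u∈C = contradiction u∈U (C∉U u∈C)

      Ω∩U⊆p : u ∈ Ω → u ∈ U → u ∈ bag p
      Ω∩U⊆p u∈Ω u∈U = N⊆p (Ω∩U⊆N u∈Ω u∈U)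

      Ω∖U⊆C : u ∈ Ω → u ∉ U → u ∈ C
      Ω∖U⊆C u∈Ω u∉U with Ω.local u∈Ω
      ... | inj₁ u∈N = contradiction (N⊆U u∈N) u∉U
      ... | inj₂ u∈C = u∈C

      closed′ : u ∈ Ω → u ∉ U → w ∈ U → u ~ w → w ∈ Ω
      closed′ u∈Ω u∉U w∈U e = Ω.nbhd⊆ (∈-nbhd⁺ (λ w∈C → C∉U w∈C w∈U) (Ω∖U⊆C u∈Ω u∉U) e)

      grows : ∃[ c ] (c ∈ U ∪ Ω × c ∉ U)
      grows = let c , c∈C , c∈Ω = Ω.meets in c , x∈p∪q⁺ (inj₂ c∈Ω) , C∉U c∈C

      ∉U∪Ω : u ∉ U → u ∉ Ω → u ∉ U ∪ Ω
      ∉U∪Ω u∉U u∉Ω u∈ with x∈p∪q⁻ U Ω u∈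
      ... | inj₁ u∈U = u∉U u∈U
      ... | inj₂ u∈Ω = u∉Ω u∈Ω

      ⊆V∖U : Component (V G ∖ (U ∪ Ω)) D → D ⊆ V G ∖ U
      ⊆V∖U isD u∈D = let u∈V , u∉ = ∈-∖⁻ (within isD u∈D) in ∈-∖⁺ u∈V (u∉ ∘ x∈p∪q⁺ ∘ inj₁)

      ⊆C : Component (V G ∖ (U ∪ Ω)) D → u ∈ D → u ∈ C → D ⊆ C
      ⊆C isD = sweep (connected isD) λ a∈C b∈D → closed isC a∈C (⊆V∖U isD b∈D)

      pending′ : Component (V G ∖ (U ∪ Ω)) D →
        Backed D × ∃[ q ] (q ∈ V (addLeaf T p∈T) × nbhd D ⊆ attachBag bag Ω q)
      pending′ {D} isD with d , d∈D ← nonempty isD with d ∈? C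
      -- Inside `C`, a remaining component is a component of `G - Ω`, as `nbhd C` lies in `Ω`. Its
      -- neighbours are in the new bag, at node `zero`.
      ... | yes d∈C = Ω.backed D-component , zero , here , λ w∈N → ∉-∖⇒∈ (nbhd⊆V w∈N) (nbhd-outside D-component w∈N)
        where
        D-component : Component (V G ∖ Ω) D
        D-component = record
          { within    = λ u∈D → let u∈V , u∉ = ∈-∖⁻ (within isD u∈D) in ∈-∖⁺ u∈V (u∉ ∘ x∈p∪q⁺ ∘ inj₂)
          ; nonempty  = nonempty isD
          ; connected = connected isD
          ; closed    = λ {u} {w} u∈D w∈ e →
              let w∈V , w∉Ω = ∈-∖⁻ w∈
                  w∈C = decidable-stable (w ∈? C) λ w∉C → w∉Ω (Ω.nbhd⊆ (∈-nbhd⁺ w∉C (⊆C isD d∈D d∈C u∈D) e))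
              in closed isD u∈D (∈-∖⁺ w∈V (∉U∪Ω (C∉U w∈C) w∉Ω)) e
          }
      -- Outside `C` nothing changes: the new vertices all lie in `C`, so the component was pending
      -- already and keeps its node.
      ... | no  d∉C = let D-backed , q , q∈T , N⊆q = pending D-component in D-backed , suc q , there q∈T , N⊆q
        where
        D∩C : u ∈ D → u ∉ C
        D∩C u∈D u∈C = d∉C (⊆C isD u∈D u∈C d∈D)
        D-component : Component (V G ∖ U) D
        D-component = record
          { within    = ⊆V∖U isD
          ; nonempty  = nonempty isD
          ; connected = connected isD
          ; closed    = λ {u} {w} u∈D w∈ e →
              let w∈V , w∉U = ∈-∖⁻ w∈
              in closed isD u∈D (∈-∖⁺ w∈V (∉U∪Ω w∉U λ w∈Ω →
                   D∩C u∈D (closed isC (Ω∖U⊆C w∈Ω w∉U) (⊆V∖U isD u∈D) (~-sym e)))) e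
          }

    boundedDecomposition : Σ (TreeDecomposition G) λ 𝒯 → let open TreeDecomposition 𝒯 in
      ∀ {t} → t ∈ V T → IndependenceBounded G b (bag t)
    boundedDecomposition = complete-partial (⊃-wellFounded ∅) empty-partial
      where
      complete-partial : ∀ {U} → Acc (λ p q → q ⊂ p) U → Partial U → Σ (TreeDecomposition G) λ 𝒯 →
        let open TreeDecomposition 𝒯 in ∀ {t} → t ∈ V T → IndependenceBounded G b (bag t)
      complete-partial {U} (acc rec) 𝒫 with nonempty? (V G ∖ U)
      ... | yes (v , v∈) = let _ , 𝒫′ , U⊂ = extend 𝒫 v∈ in complete-partial (rec U⊂) 𝒫′
      ... | no  done     = spanning {G = G} (λ u∈G → ∉-∖⇒∈ u∈G λ u∈ → done (_ , u∈)) (Partial.𝒯 𝒫) , Partial.bounded 𝒫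

-- The case of minimal separators, and all four cases together.

separatorSize⇒treeIndependenceNumber : {G : Graph n} → MaximumMinimalSeparatorSize G AtMost (+ k) →
  TreeIndependenceNumber G AtMost (+ ((k + 2) * suc k))
separatorSize⇒treeIndependenceNumber {k = k} {G} bound =
  let 𝒯 , bounded = boundedDecomposition G small in treeIndependenceNumber≤ 𝒯 bounded
  where
  small : ∀ {S} → MinimalSeparator G S → ∣ S ∣ ≤ k
  small {S} sep = decidable-stable (∣ S ∣ ℕ.≤? k) λ S≰k → maximumMinimalSeparatorSize-defined G
    λ (m , size@((_ , above) , _)) → S≰k (ℤ.drop‿+≤+ (ℤ.≤-trans (above sep) (bound m size)))

theorem3p12 : {ℓ : Level} (𝒢 : GraphClass ℓ) →
    (Bounded Treewidth 𝒢 ⊎ Bounded IndependenceNumber 𝒢 ⊎ Bounded IntersectionTreewidth 𝒢 ⊎ Bounded MaximumMinimalSeparatorSize 𝒢) →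
    Bounded TreeIndependenceNumber 𝒢
theorem3p12 𝒢 (inj₁ (_ , bound)) =
  _ , λ G G∈𝒢 → treewidth⇒treeIndependenceNumber {G = G} (AtMost-∣∣ (bound G G∈𝒢))
theorem3p12 𝒢 (inj₂ (inj₁ (_ , bound))) =
  _ , λ G G∈𝒢 → independenceNumber⇒treeIndependenceNumber {G = G} (AtMost-∣∣ (bound G G∈𝒢))
theorem3p12 𝒢 (inj₂ (inj₂ (inj₁ (_ , bound)))) =
  _ , λ G G∈𝒢 → intersectionTreewidth⇒treeIndependenceNumber {G = G} (AtMost-∣∣ (bound G G∈𝒢))
theorem3p12 𝒢 (inj₂ (inj₂ (inj₂ (_ , bound)))) =
  _ , λ G G∈𝒢 → separatorSize⇒treeIndependenceNumber {G = G} (AtMost-∣∣ (bound G G∈𝒢))
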